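{- Every P$'$-graph is a P$'''$-graph.
   Context: A graph is given by two functions $W,E\colon A\to V$ ($A$ the edges, $V$ the vertices, assumed disjoint); an edge $a$ goes from $W(a)$ to $E(a)$. For $X\in\{W,E\}$ let $\bar W=E$, $\bar E=W$. A vertex $v$ is an $X$-vertex if there is no edge $a$ with $\bar X(a)=v$; a vertex that is neither a $W$-vertex nor an $E$-vertex is inner. An edge $a$ is an $X$-edge if $X(a)$ is an $X$-vertex, and inner if it is neither a $W$-edge nor an $E$-edge. A semipath is a sequence $v_0a_1v_1\ldots a_nv_n$ ($n\ge 0$) where each $a_i$ joins $v_{i-1}$ and $v_i$ in either direction and no vertex occurs twice; a walk/path is the same with all edges going from $v_{i-1}$ to $v_i$. A D-graph is a finite graph that is acyclic (no directed cycles), $W$-$E$-functional (for every $X$-edge $a$, no other edge $b$ has $X(b)=X(a)$), weakly connected (any two vertices are joined by a semipath), and has at least one inner vertex; a basic D-graph is one with exactly one inner vertex. $X(D)$ denotes the set of $X$-vertices of $D$. Juncture: for D-graphs $D_W$ ($W_W,E_W\colon A_W\to V_W$) and $D_E$ ($W_E,E_E\colon A_E\to V_E$), suppose $C=A_W\cap A_E\neq\emptyset$, for every $a\in C$ we have $E_W(a)=W_E(a)$, $a$ is an $E$-edge of $D_W$ and a $W$-edge of $D_E$, and $V_W\cap V_E=V_C=\{E_W(a)\mid a\in C\}$. Then $D_W\Box D_E$ has edges $A_W\cup A_E$, vertices $(V_W\cup V_E)-V_C$, $W(a)=W_W(a)$ for $a\in A_W$ and $W(a)=W_E(a)$ for $a\in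 A_E-C$, $E(a)=E_E(a)$ for $a\in A_E$ and $E(a)=E_W(a)$ for $a\in A_W-C$. A list is a finite sequence of distinct elements. Two non-empty lists are compatible when they are of the forms $\Phi\Xi$ and $\Xi\Psi$, or $\Phi\Xi\Psi$ and $\Xi$, with $\Phi,\Xi,\Psi$ mutually disjoint and $\Xi$ non-empty. A construction (of a P$'$-graph) is a finite binary tree with a triple $(D,L_W,L_E)$ in each node, $D$ a D-graph and $L_X$ a list of all of $X(D)$: (1) a single node with a basic D-graph and arbitrary such lists is a construction; (2) if $K_W,K_E$ are constructions with roots $(D_W,L^W_W,L^W_E)$ and $(D_E,L^E_W,L^E_E)$ where $L^W_E=\Phi_E\Xi\Psi_E$ and $L^E_W=\Phi_W\Xi\Psi_W$ are compatible, then adding a new root $(D_W\Box D_E,\;\Phi_WL^W_W\Psi_W,\;\Phi_EL^E_E\Psi_E)$ with children the roots of $K_W,K_E$ gives a construction. A P$'$-graph is the D-graph at the root of some construction. For vertices $u,v$ of a D-graph, $[u,v]$ is the set of semipaths from $u$ to $v$, and $[u]_X$ is the set of semipaths from $u$ to some $X$-vertex. For distinct $X$-vertices $u,v,w$, $\psi_X(v,u,w)$ means every semipath in $[v,w]$ shares a vertex with every semipath in $[u]_{\bar X}$. A list $\Lambda$ of $X(D)$ is grounded in $D$ if whenever $v,u,w$ occur in $\Lambda$ in the order $v,u,w$ (or $w,u,v$), not necessarily adjacently, we have $\psi_X(v,u,w)$. D-graphs $D_W,D_E$ with $D_W\Box D_E$ defined are P-compatible when some list of $E(D_W)$ grounded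 in $D_W$ and some list of $W(D_E)$ grounded in $D_E$ are compatible. A cocycle of a D-graph $D$ is a non-empty set $C$ of inner edges whose removal leaves exactly two components $D_1,D_2$, with every edge of $C$ going from a vertex of $D_1$ to a vertex of $D_2$. Cutting $D$ through $C$ gives $D_W$ (from $D_1$ by adding the edges of $C$, each $a\in C$ keeping its $W(a)$ and getting a new vertex $v_a$ as $E(a)$) and $D_E$ (from $D_2$ by adding the edges of $C$ with $E(a)$ as in $D$ and $W(a)=v_a$); then $D=D_W\Box D_E$. A P$'''$-graph is a D-graph $D$ such that for every cocycle $C$ of $D$ the two D-graphs obtained by cutting $D$ through $C$ are P-compatible. -}

module Defs where

open import Data.Nat using (ℕ; _≟_)
open import Data.Bool using (if_then_else_)
open import Data.List using (List; []; _∷_; _++_; map; filter)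
open import Data.List.Membership.Propositional using (_∈_; _∉_)
open import Data.List.Membership.DecPropositional _≟_ using (_∈?_)
open import Data.List.Relation.Unary.Unique.Propositional using (Unique)
open import Data.List.Relation.Binary.Disjoint.Propositional using (Disjoint)
open import Data.List.Relation.Binary.Sublist.Propositional using () renaming (_⊆_ to _⊑_)
open import Data.Product using (Σ; ∃; ∃-syntax; _×_; _,_)
open import Data.Sum using (_⊎_)
open import Data.Unit using (⊤)
open import Relation.Nullary using (¬_; does; ¬?)
open import Relation.Binary.PropositionalEquality using (_≡_; _≢_)

-- Graphs.  Edge names and vertex names are both natural numbers, but
-- they live in two separate name spaces (edges and vertices are never
-- compared with each other), which realises the disjointness of A and V.
-- The finite sets A and V are given as lists; only membership matters.
-- W and E are total functions on ℕ; only their values on A matter.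

record Graph : Set where
  constructor graph
  field
    A : List ℕ          -- edges
    V : List ℕ          -- vertices
    W : ℕ → ℕ           -- west end of an edge
    E : ℕ → ℕ           -- east end of an edge

open Graph public

data Side : Set where
  west east : Side

opp : Side → Side
opp west = east
opp east = west

end : Side → Graph → ℕ → ℕ
end west D = W D
end east D = E D

IsVertexOf : Side → Graph → ℕ → Set
IsVertexOf X D v = v ∈ V D × (∀ a → a ∈ A D → end (opp X) D a ≢ v)

IsInnerVertex : Graph → ℕ → Set
IsInnerVertex D v = v ∈ V D × ¬ IsVertexOf west D v × ¬ IsVertexOf east D v

IsEdgeOf : Side → Graph → ℕ → Set
IsEdgeOf X D a = a ∈ A D × IsVertexOf X D (end X D a)

IsInnerEdge : Graph → ℕ → Set
IsInnerEdge D a = a ∈ A D × ¬ IsEdgeOf west D a × ¬ IsEdgeOf east D a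

data Walk (D : Graph) : ℕ → ℕ → Set where
  nil  : ∀ {v} → Walk D v v
  cons : ∀ {u v} a → a ∈ A D → W D a ≡ u → Walk D (E D a) v → Walk D u v

Acyclic : Graph → Set
Acyclic D = ∀ a → a ∈ A D → ¬ Walk D (E D a) (W D a)

-- Semipaths  v₀ a₁ v₁ … aₙ vₙ : a start vertex and a list of steps (aᵢ , vᵢ)

Joins : Graph → ℕ → ℕ → ℕ → Set
Joins D a u v = (W D a ≡ u × E D a ≡ v) ⊎ (E D a ≡ u × W D a ≡ v)

Linked : Graph → ℕ → List (ℕ × ℕ) → Set
Linked D u []             = ⊤
Linked D u ((a , v) ∷ s)  = a ∈ A D × v ∈ V D × Joins D a u v × Linked D v s

lastV : ℕ → List (ℕ × ℕ) → ℕ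
lastV u []            = u
lastV u ((a , v) ∷ s) = lastV v s

record Semipath (D : Graph) : Set where
  constructor semipath
  field
    start  : ℕ
    steps  : List (ℕ × ℕ)
    startV : start ∈ V D
    linked : Linked D start steps
    uniq   : Unique (start ∷ map Data.Product.proj₂ steps)

open Semipath public

spVerts : ∀ {D} → Semipath D → List ℕ
spVerts p = start p ∷ map Data.Product.proj₂ (steps p)

spEnd : ∀ {D} → Semipath D → ℕ
spEnd p = lastV (start p) (steps p)

InSP : (D : Graph) → Semipath D → ℕ → ℕ → Set
InSP D p u v = start p ≡ u × spEnd p ≡ v

InSPX : (D : Graph) → Semipath D → ℕ → Side → Set
InSPX D p u X = start p ≡ u × IsVertexOf X D (spEnd p)

WellFormed : Graph → Set
WellFormed D = Unique (A D) × Unique (V D) ×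
               (∀ a → a ∈ A D → W D a ∈ V D × E D a ∈ V D)

WEFunctional : Graph → Set
WEFunctional D = ∀ X a → IsEdgeOf X D a →
                 ∀ b → b ∈ A D → b ≢ a → end X D b ≢ end X D a

WeaklyConnected : Graph → Set
WeaklyConnected D = ∀ u v → u ∈ V D → v ∈ V D →
                    Σ (Semipath D) λ p → InSP D p u v

IsDGraph : Graph → Set
IsDGraph D = WellFormed D × Acyclic D × WEFunctional D × WeaklyConnected D ×
             (∃ λ v → IsInnerVertex D v)

IsBasicDGraph : Graph → Set
IsBasicDGraph D = IsDGraph D ×
                  (∃ λ v → IsInnerVertex D v × (∀ u → IsInnerVertex D u → u ≡ v))

JunctureDefined : Graph → Graph → Set
JunctureDefined DW DE =
  (∃ λ a → a ∈ A DW × a ∈ A DE) ×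
  (∀ a → a ∈ A DW → a ∈ A DE →
     E DW a ≡ W DE a × IsEdgeOf east DW a × IsEdgeOf west DE a) ×
  (∀ v → v ∈ V DW → v ∈ V DE → ∃ λ a → a ∈ A DW × a ∈ A DE × E DW a ≡ v) ×
  (∀ a → a ∈ A DW → a ∈ A DE → E DW a ∈ V DW × E DW a ∈ V DE)

common : Graph → Graph → List ℕ
common DW DE = filter (λ a → a ∈? A DE) (A DW)

commonV : Graph → Graph → List ℕ
commonV DW DE = map (E DW) (common DW DE)

_□_ : Graph → Graph → Graph
DW □ DE = graph
  (A DW ++ filter (λ a → ¬? (a ∈? A DW)) (A DE))
  (filter (λ v → ¬? (v ∈? commonV DW DE))
          (V DW ++ filter (λ v → ¬? (v ∈? V DW)) (V DE)))
  (λ a → if does (a ∈? A DW) then W DW a else W DE a)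
  (λ a → if does (a ∈? A DE) then E DE a else E DW a)

IsListOf : Side → Graph → List ℕ → Set
IsListOf X D L = Unique L × (∀ v → v ∈ L → IsVertexOf X D v)
                          × (∀ v → IsVertexOf X D v → v ∈ L)

Disj3 : List ℕ → List ℕ → List ℕ → Set
Disj3 Φ Ξ Ψ = Disjoint Φ Ξ × Disjoint Ξ Ψ × Disjoint Φ Ψ

data Compatible : List ℕ → List ℕ → Set where
  c₁ : ∀ {L₁ L₂} Φ Ξ Ψ → Disj3 Φ Ξ Ψ → Ξ ≢ [] →
       L₁ ≡ Φ ++ Ξ → L₂ ≡ Ξ ++ Ψ → Compatible L₁ L₂
  c₂ : ∀ {L₁ L₂} Φ Ξ Ψ → Disj3 Φ Ξ Ψ → Ξ ≢ [] →
       L₁ ≡ Ξ ++ Ψ → L₂ ≡ Φ ++ Ξ → Compatible L₁ L₂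
  c₃ : ∀ {L₁ L₂} Φ Ξ Ψ → Disj3 Φ Ξ Ψ → Ξ ≢ [] →
       L₁ ≡ Φ ++ Ξ ++ Ψ → L₂ ≡ Ξ → Compatible L₁ L₂
  c₄ : ∀ {L₁ L₂} Φ Ξ Ψ → Disj3 Φ Ξ Ψ → Ξ ≢ [] →
       L₁ ≡ Ξ → L₂ ≡ Φ ++ Ξ ++ Ψ → Compatible L₁ L₂

-- For compatible L^W_E = Φ_E Ξ Ψ_E and L^E_W = Φ_W Ξ Ψ_W, the new lists
-- Φ_W L^W_W Ψ_W  and  Φ_E L^E_E Ψ_E.
newWList : ∀ {L₁ L₂} → Compatible L₁ L₂ → List ℕ → List ℕ
newWList (c₁ Φ Ξ Ψ _ _ _ _) LWW = LWW ++ Ψ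
newWList (c₂ Φ Ξ Ψ _ _ _ _) LWW = Φ ++ LWW
newWList (c₃ Φ Ξ Ψ _ _ _ _) LWW = LWW
newWList (c₄ Φ Ξ Ψ _ _ _ _) LWW = Φ ++ LWW ++ Ψ

newEList : ∀ {L₁ L₂} → Compatible L₁ L₂ → List ℕ → List ℕ
newEList (c₁ Φ Ξ Ψ _ _ _ _) LEE = Φ ++ LEE
newEList (c₂ Φ Ξ Ψ _ _ _ _) LEE = LEE ++ Ψ
newEList (c₃ Φ Ξ Ψ _ _ _ _) LEE = Φ ++ LEE ++ Ψ
newEList (c₄ Φ Ξ Ψ _ _ _ _) LEE = LEE

-- Constructions; the index is the triple at the root.  Every node carries
-- a D-graph D and lists L_W, L_E of all of W(D), E(D).

data Construction : Graph → List ℕ → List ℕ → Set where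
  leaf : ∀ {D LW LE} → IsBasicDGraph D →
         IsListOf west D LW → IsListOf east D LE →
         Construction D LW LE
  node : ∀ {DW LWW LWE DE LEW LEE} →
         Construction DW LWW LWE → Construction DE LEW LEE →
         JunctureDefined DW DE →
         (c : Compatible LWE LEW) →
         IsDGraph (DW □ DE) →
         IsListOf west (DW □ DE) (newWList c LWW) →
         IsListOf east (DW □ DE) (newEList c LEE) →
         Construction (DW □ DE) (newWList c LWW) (newEList c LEE)

IsP′Graph : Graph → Set
IsP′Graph D = ∃ λ LW → ∃ λ LE → Construction D LW LE

ψ : Side → (D : Graph) → ℕ → ℕ → ℕ → Set
ψ X D v u w = (p : Semipath D) → InSP D p v w →
              (q : Semipath D) → InSPX D q u (opp X) →
              ∃ λ x → x ∈ spVerts p × x ∈ spVerts q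

Grounded : Side → Graph → List ℕ → Set
Grounded X D Λ = ∀ v u w → (v ∷ u ∷ w ∷ []) ⊑ Λ → ψ X D v u w × ψ X D w u v

PCompatible : Graph → Graph → Set
PCompatible DW DE =
  ∃ λ L₁ → ∃ λ L₂ →
    IsListOf east DW L₁ × Grounded east DW L₁ ×
    IsListOf west DE L₂ × Grounded west DE L₂ ×
    Compatible L₁ L₂

removeEdges : Graph → List ℕ → Graph
removeEdges D C = graph (filter (λ a → ¬? (a ∈? C)) (A D)) (V D) (W D) (E D)

-- C is a cocycle of D, where removing C leaves exactly the two components
-- with vertex sets V₁ (containing the W-ends of C) and V₂ (the E-ends).
IsCocycle : Graph → List ℕ → List ℕ → List ℕ → Set
IsCocycle D C V₁ V₂ =
  Unique C × C ≢ [] × (∀ a → a ∈ C → IsInnerEdge D a) ×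
  Unique V₁ × Unique V₂ × V₁ ≢ [] × V₂ ≢ [] × Disjoint V₁ V₂ ×
  (∀ v → v ∈ V D → v ∈ V₁ ⊎ v ∈ V₂) ×
  (∀ v → v ∈ V₁ → v ∈ V D) × (∀ v → v ∈ V₂ → v ∈ V D) ×
  (∀ u v → u ∈ V₁ → v ∈ V₁ → Σ (Semipath (removeEdges D C)) λ p → InSP _ p u v) ×
  (∀ u v → u ∈ V₂ → v ∈ V₂ → Σ (Semipath (removeEdges D C)) λ p → InSP _ p u v) ×
  (∀ a → a ∈ A D → a ∉ C → (W D a ∈ V₁ × E D a ∈ V₁) ⊎ (W D a ∈ V₂ × E D a ∈ V₂)) ×
  (∀ a → a ∈ C → W D a ∈ V₁ × E D a ∈ V₂)

FreshNames : Graph → List ℕ → (ℕ → ℕ) → Set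
FreshNames D C ν = (∀ a → a ∈ C → ν a ∉ V D) ×
                   (∀ a b → a ∈ C → b ∈ C → ν a ≡ ν b → a ≡ b)

-- edges of D₁ (resp. D₂): edges of D − C with both ends in V₁ (resp. V₂)
edgesIn : Graph → List ℕ → List ℕ → List ℕ
edgesIn D C Vi = filter (λ a → W D a ∈? Vi) (A (removeEdges D C))

cutW : Graph → List ℕ → List ℕ → (ℕ → ℕ) → Graph
cutW D C V₁ ν = graph
  (edgesIn D C V₁ ++ C)
  (V₁ ++ map ν C)
  (W D)
  (λ a → if does (a ∈? C) then ν a else E D a)

cutE : Graph → List ℕ → List ℕ → (ℕ → ℕ) → Graph
cutE D C V₂ ν = graph
  (edgesIn D C V₂ ++ C)
  (V₂ ++ map ν C)
  (λ a → if does (a ∈? C) then ν a else W D a)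
  (E D)

IsP‴Graph : Graph → Set
IsP‴Graph D = IsDGraph D ×
  (∀ C V₁ V₂ ν → IsCocycle D C V₁ V₂ → FreshNames D C ν →
     PCompatible (cutW D C V₁ ν) (cutE D C V₂ ν))

{-# OPTIONS --safe #-}
module Submission where

-- A construction draws its graph as a sweep: slices, which are lists of edges, lead from the list
-- of W-edges to the list of E-edges, and each step replaces the consecutive in-edges of one inner
-- vertex by its out-edges.  Steps at vertices not joined by an edge commute, so for a cocycle the
-- inner vertices of V₁ can be swept first; the slice μ then reached contains the cocycle.
--
-- For edge sets p and q let the crossing number of a slice be the number modulo 2 of pairs i < j
-- of positions with the i-th edge in p and the j-th in q.  A step does not change it if p and q
-- have even degree at the vertex and one of them is empty there.  Now let p be a semipath joining
-- the first and third of three edges of μ inside one piece, and let q leave μ through the second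
-- edge without meeting p: the crossing number is 1 at μ, but 0 at the far end of the piece, which
-- p does not reach.  With q a semipath of the same piece, this shows that the lists are grounded.
-- With q a single edge outside the piece, it shows that the edges of each piece are consecutive
-- in μ, hence that the lists are compatible.

open import Defs
open import Data.Bool using (Bool; true; false; not; _∧_; _xor_; if_then_else_)
open import Data.Bool.Properties using (xor-assoc; xor-comm; xor-same; xor-identityʳ; ∧-zeroʳ)
open import Data.Bool.Solver using (module xor-∧-Solver)
open import Data.Empty using (⊥; ⊥-elim)
open import Data.List using (List; []; _∷_; _++_; map; filter; length)
open import Data.List.Membership.Propositional using (_∈_; _∉_; find; lose)
open import Data.List.Membership.Propositional.Properties
  using (∈-++⁺ˡ; ∈-++⁺ʳ; ∈-++⁻; ∈-map⁺; ∈-map⁻; ∈-filter⁺; ∈-filter⁻)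
open import Data.List.Properties
  using (++-assoc; ++-identityʳ; map-++; filter-++; filter-accept; filter-reject; filter-all;
         filter-none; length-++; ∷-injective; ∷-injectiveˡ;
         map-cong-local)
open import Data.List.Relation.Binary.Disjoint.Propositional using (Disjoint)
open import Data.List.Relation.Binary.Disjoint.Propositional.Properties
  using () renaming (sym to Disjoint-sym)
open import Data.List.Relation.Binary.Sublist.Propositional using ([]; _∷ʳ_; _∷_; from∈)
  renaming (_⊆_ to _⊑_; ⊆-trans to ⊑-trans; lookup to ⊑-lookup)
open import Data.List.Relation.Binary.Sublist.Propositional.Properties using (filter-⊆)
open import Data.List.Relation.Unary.All as All using (All; []; _∷_)
open import Data.List.Relation.Unary.All.Properties using (¬All⇒Any¬)
open import Data.List.Relation.Unary.AllPairs using ([]; _∷_)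
open import Data.List.Relation.Unary.Any using (here; there; any?)
open import Data.List.Relation.Unary.Unique.Propositional using (Unique)
open import Data.List.Relation.Unary.Unique.Propositional.Properties
  using (Unique[x∷xs]⇒x∉xs; map⁻) renaming (++⁺ to Unique-++⁺; filter⁺ to Unique-filter⁺)
open import Data.Nat using (ℕ; suc; _+_; _≤_; _≟_; s≤s⁻¹; z≤n)
open import Data.List.Membership.DecPropositional _≟_ using (_∈?_)
open import Data.Nat.Properties using (m+n≡0⇒m≡0; m≤m+n; n≤1+n; n≤0⇒n≡0; ≤-trans; +-cancelʳ-≡)
open import Data.Nat.Tactic.RingSolver using (solve-∀)
open import Data.Product using (Σ; ∃; _×_; _,_; proj₁; proj₂)
open import Data.Sum as Sum using (_⊎_; inj₁; inj₂; [_,_]′)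
open import Function using (id)
open import Relation.Nullary using (¬_; Dec; yes; no; does; ¬?; contradiction)
open import Relation.Nullary.Decidable using (dec-true; dec-false; decidable-stable; toSum)
open import Relation.Binary.PropositionalEquality
  using (_≡_; _≢_; refl; sym; trans; cong; cong₂; subst; module ≡-Reasoning)

open xor-∧-Solver using (solve; _:+_; _:*_; _:=_)

-- Enumerations, multiplicities and factorisations of lists

_Enumerates_ : List ℕ → (ℕ → Set) → Set
l Enumerates P = Unique l × (∀ a → a ∈ l → P a) × (∀ a → P a → a ∈ l)

Enumerates-resp : ∀ {l P Q} → (∀ a → P a → Q a) → (∀ a → Q a → P a) →
                  l Enumerates P → l Enumerates Q
Enumerates-resp P⇒Q Q⇒P (u , s , c) = u , (λ a a∈ → P⇒Q a (s a a∈)) , (λ a q → c a (Q⇒P a q))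

-- Slices are counted with multiplicity because nothing in a sweep forbids repeated edges outright.
-- The counts obey a linear conservation law, from which uniqueness is recovered.
mult : ℕ → List ℕ → ℕ
mult a l = length (filter (a ≟_) l)

mult-++ : ∀ a l m → mult a (l ++ m) ≡ mult a l + mult a m
mult-++ a l m = trans (cong length (filter-++ (a ≟_) l m)) (length-++ (filter (a ≟_) l))

mult-∉ : ∀ {a l} → a ∉ l → mult a l ≡ 0
mult-∉ {a} {l} a∉ = cong length (filter-none (a ≟_) (All.tabulate λ { b∈ refl → a∉ b∈ }))

mult-here : ∀ a l → mult a (a ∷ l) ≡ suc (mult a l)
mult-here a l = cong length (filter-accept (a ≟_) refl)

mult-there : ∀ {a b} l → a ≢ b → mult a (b ∷ l) ≡ mult a l
mult-there {a} l a≢b = cong length (filter-reject (a ≟_) a≢b)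

mult-∈ : ∀ {a l} → Unique l → a ∈ l → mult a l ≡ 1
mult-∈ {a} {_ ∷ l} u (here refl) =
  trans (mult-here a l) (cong suc (mult-∉ (Unique[x∷xs]⇒x∉xs u)))
mult-∈ {a} {b ∷ l} u@(_ ∷ u′) (there a∈) =
  trans (mult-there l λ { refl → Unique[x∷xs]⇒x∉xs u a∈ }) (mult-∈ u′ a∈)

mult≡0⇒∉ : ∀ {a l} → mult a l ≡ 0 → a ∉ l
mult≡0⇒∉ {a} {_ ∷ l} m (here refl) with () ← trans (sym (mult-here a l)) m
mult≡0⇒∉ {a} {b ∷ l} m (there a∈) with a ≟ b
... | yes refl with () ← trans (sym (mult-here a l)) m
... | no a≢b = mult≡0⇒∉ (trans (sym (mult-there l a≢b)) m) a∈

mult≤1⇒Unique : ∀ l → (∀ a → a ∈ l → mult a l ≤ 1) → Unique l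
mult≤1⇒Unique [] h = []
mult≤1⇒Unique (b ∷ l) h =
  All.tabulate (λ { c∈ refl → b∉ c∈ }) ∷ mult≤1⇒Unique l (λ a a∈ → tail a (h a (there a∈)))
  where
  b∉ : b ∉ l
  b∉ = mult≡0⇒∉ (n≤0⇒n≡0 (s≤s⁻¹ (subst (_≤ 1) (mult-here b l) (h b (here refl)))))
  tail : ∀ a → mult a (b ∷ l) ≤ 1 → mult a l ≤ 1
  tail a m≤1 with a ≟ b
  ... | yes refl = ≤-trans (n≤1+n _) (subst (_≤ 1) (mult-here a l) m≤1)
  ... | no a≢b = subst (_≤ 1) (mult-there l a≢b) m≤1

-- If `I` started inside `O`, its first element would lie in both; so `Φ` has to cover all of `O`.
factor-skip : ∀ O {I : List ℕ} {Ψ} Φ {Ψ′} → (∀ a → a ∈ O → a ∉ I) → I ≢ [] →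
              O ++ Ψ ≡ Φ ++ I ++ Ψ′ → ∃ λ Θ → Φ ≡ O ++ Θ × Ψ ≡ Θ ++ I ++ Ψ′
factor-skip [] Φ O∩I I≢[] eq = Φ , refl , eq
factor-skip (o ∷ O) {[]} [] O∩I I≢[] eq = contradiction refl I≢[]
factor-skip (o ∷ O) {i ∷ I} [] O∩I I≢[] eq =
  ⊥-elim (O∩I o (here refl) (here (∷-injectiveˡ eq)))
factor-skip (o ∷ O) (y ∷ Φ) O∩I I≢[] eq with ∷-injective eq
... | refl , eq′ with factor-skip O Φ (λ a a∈ → O∩I a (there a∈)) I≢[] eq′
... | Θ , refl , eqΨ = Θ , refl , eqΨ

-- Stripping common heads until one of the prefixes is empty leaves the situation of `factor-skip`.
-- In use, `O` is what one step produces and `I` what the next one consumes.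
factors-ordered : ∀ (Φ : List ℕ) {O Ψ} Φ′ {I Ψ′} → (∀ a → a ∈ O → a ∉ I) → O ≢ [] → I ≢ [] →
  Φ ++ O ++ Ψ ≡ Φ′ ++ I ++ Ψ′ →
  (∃ λ Θ → Φ ≡ Φ′ ++ I ++ Θ × Ψ′ ≡ Θ ++ O ++ Ψ) ⊎
  (∃ λ Θ → Φ′ ≡ Φ ++ O ++ Θ × Ψ ≡ Θ ++ I ++ Ψ′)
factors-ordered [] {O} Φ′ O∩I O≢[] I≢[] eq = inj₂ (factor-skip O Φ′ O∩I I≢[] eq)
factors-ordered (y ∷ Φ) [] {I} O∩I O≢[] I≢[] eq =
  inj₁ (factor-skip I (y ∷ Φ) (λ a a∈I a∈O → O∩I a a∈O a∈I) O≢[] (sym eq))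
factors-ordered (y ∷ Φ) (z ∷ Φ′) O∩I O≢[] I≢[] eq with ∷-injective eq
... | refl , eq′ with factors-ordered Φ Φ′ O∩I O≢[] I≢[] eq′
... | inj₁ (Θ , refl , eqΨ) = inj₁ (Θ , refl , eqΨ)
... | inj₂ (Θ , refl , eqΨ) = inj₂ (Θ , refl , eqΨ)

⊑-map⁻ : ∀ (f : ℕ → ℕ) {xs} l → xs ⊑ map f l → ∃ λ ys → ys ⊑ l × xs ≡ map f ys
⊑-map⁻ f [] [] = [] , [] , refl
⊑-map⁻ f (a ∷ l) (_ ∷ʳ s) with ⊑-map⁻ f l s
... | ys , s′ , eq = ys , a ∷ʳ s′ , eq
⊑-map⁻ f (a ∷ l) (refl ∷ s) with ⊑-map⁻ f l s
... | ys , s′ , refl = a ∷ ys , refl ∷ s′ , refl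

-- Parities

_==_ : ℕ → ℕ → Bool
a == b = does (a ≟ b)

parity : (ℕ → Bool) → List ℕ → Bool
parity p [] = false
parity p (a ∷ l) = p a xor parity p l

crossing : (ℕ → Bool) → (ℕ → Bool) → List ℕ → Bool
crossing p q [] = false
crossing p q (a ∷ l) = (p a ∧ parity q l) xor crossing p q l

xor-interchange : ∀ a b c d → (a xor b) xor (c xor d) ≡ (a xor c) xor (b xor d)
xor-interchange a b c d = begin
  (a xor b) xor (c xor d)  ≡⟨ xor-assoc a b (c xor d) ⟩
  a xor (b xor (c xor d))  ≡⟨ cong (a xor_) (sym (xor-assoc b c d)) ⟩
  a xor ((b xor c) xor d)  ≡⟨ cong (λ z → a xor (z xor d)) (xor-comm b c) ⟩
  a xor ((c xor b) xor d)  ≡⟨ cong (a xor_) (xor-assoc c b d) ⟩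
  a xor (c xor (b xor d))  ≡⟨ sym (xor-assoc a c (b xor d)) ⟩
  (a xor c) xor (b xor d)  ∎ where open ≡-Reasoning

parity-++ : ∀ p l m → parity p (l ++ m) ≡ parity p l xor parity p m
parity-++ p [] m = refl
parity-++ p (a ∷ l) m = trans (cong (p a xor_) (parity-++ p l m)) (sym (xor-assoc (p a) _ _))

parity-xor : ∀ p r l → parity (λ a → p a xor r a) l ≡ parity p l xor parity r l
parity-xor p r [] = refl
parity-xor p r (a ∷ l) =
  trans (cong ((p a xor r a) xor_) (parity-xor p r l)) (xor-interchange (p a) (r a) _ _)

parity-false : ∀ p {l} → (∀ a → a ∈ l → p a ≡ false) → parity p l ≡ false
parity-false p {[]} h = refl
parity-false p {a ∷ l} h rewrite h a (here refl) = parity-false p (λ b b∈ → h b (there b∈))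

parity-cong : ∀ {p r} l → (∀ a → a ∈ l → p a ≡ r a) → parity p l ≡ parity r l
parity-cong [] h = refl
parity-cong (a ∷ l) h =
  cong₂ _xor_ (h a (here refl)) (parity-cong l (λ b b∈ → h b (there b∈)))

parity-single-∉ : ∀ {b l} → b ∉ l → parity (_== b) l ≡ false
parity-single-∉ {b} b∉ = parity-false (_== b) (λ a a∈ → dec-false (a ≟ b) λ { refl → b∉ a∈ })

parity-single-∈ : ∀ {b l} → Unique l → b ∈ l → parity (_== b) l ≡ true
parity-single-∈ {b} {_ ∷ l} u (here refl)
  rewrite dec-true (b ≟ b) refl | parity-single-∉ {b} {l} (Unique[x∷xs]⇒x∉xs u) = refl
parity-single-∈ {b} {a ∷ l} u@(_ ∷ u′) (there b∈)
  rewrite dec-false (a ≟ b) (λ { refl → Unique[x∷xs]⇒x∉xs u b∈ }) = parity-single-∈ u′ b∈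

-- The last term counts the pairs whose first member lies in `l` and whose second lies in `m`.
crossing-++ : ∀ p q l m →
  crossing p q (l ++ m) ≡ (crossing p q l xor crossing p q m) xor (parity p l ∧ parity q m)
crossing-++ p q [] m = sym (xor-identityʳ _)
crossing-++ p q (a ∷ l) m rewrite crossing-++ p q l m | parity-++ q l m =
  lemma (p a) (parity q l) (parity q m) (crossing p q l) (crossing p q m) (parity p l)
  where
  lemma : ∀ x y z c d e → (x ∧ (y xor z)) xor ((c xor d) xor (e ∧ z)) ≡
                          (((x ∧ y) xor c) xor d) xor ((x xor e) ∧ z)
  lemma = solve 6 (λ x y z c d e → (x :* (y :+ z)) :+ ((c :+ d) :+ (e :* z)) :=
                   (((x :* y) :+ c) :+ d) :+ ((x :+ e) :* z)) refl

crossing-zeroˡ : ∀ p q l → (∀ a → a ∈ l → p a ≡ false) → crossing p q l ≡ false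
crossing-zeroˡ p q [] h = refl
crossing-zeroˡ p q (a ∷ l) h rewrite h a (here refl) = crossing-zeroˡ p q l (λ b b∈ → h b (there b∈))

crossing-zeroʳ : ∀ p q l → (∀ a → a ∈ l → q a ≡ false) → crossing p q l ≡ false
crossing-zeroʳ p q [] h = refl
crossing-zeroʳ p q (a ∷ l) h
  rewrite parity-false q {l} (λ b b∈ → h b (there b∈)) | ∧-zeroʳ (p a) =
  crossing-zeroʳ p q l (λ b b∈ → h b (there b∈))

crossing-xorˡ : ∀ p r q l →
  crossing (λ a → p a xor r a) q l ≡ crossing p q l xor crossing r q l
crossing-xorˡ p r q [] = refl
crossing-xorˡ p r q (a ∷ l) rewrite crossing-xorˡ p r q l =
  trans (cong (_xor (crossing p q l xor crossing r q l)) (lemma (p a) (r a) (parity q l)))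
        (xor-interchange (p a ∧ parity q l) (r a ∧ parity q l) _ _)
  where
  lemma : ∀ x y z → (x xor y) ∧ z ≡ (x ∧ z) xor (y ∧ z)
  lemma false y z = refl
  lemma true false z = sym (xor-identityʳ z)
  lemma true true z = sym (xor-same z)

crossing-cong : ∀ {p p′ q q′} l → (∀ a → a ∈ l → p a ≡ p′ a) → (∀ a → a ∈ l → q a ≡ q′ a) →
  crossing p q l ≡ crossing p′ q′ l
crossing-cong [] hp hq = refl
crossing-cong (a ∷ l) hp hq =
  cong₂ _xor_ (cong₂ _∧_ (hp a (here refl)) (parity-cong l (λ b b∈ → hq b (there b∈))))
    (crossing-cong l (λ b b∈ → hp b (there b∈)) (λ b b∈ → hq b (there b∈)))

crossing-ordered : ∀ {i j l} → Unique l → (i ∷ j ∷ []) ⊑ l →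
  crossing (_== i) (_== j) l ≡ true × crossing (_== j) (_== i) l ≡ false
crossing-ordered {i} {j} {y ∷ l} u@(_ ∷ u′) (_ ∷ʳ s)
  rewrite dec-false (y ≟ i) (λ { refl → Unique[x∷xs]⇒x∉xs u (⊑-lookup s (here refl)) })
        | dec-false (y ≟ j) (λ { refl → Unique[x∷xs]⇒x∉xs u (⊑-lookup s (there (here refl))) }) =
  crossing-ordered u′ s
crossing-ordered {i} {j} {_ ∷ l} u@(_ ∷ u′) (refl ∷ s)
  rewrite dec-true (i ≟ i) refl
        | dec-false (i ≟ j) (λ { refl → Unique[x∷xs]⇒x∉xs u (⊑-lookup s (here refl)) })
        | parity-single-∈ u′ (⊑-lookup s (here refl)) =
  cong not (crossing-zeroˡ (_== i) (_== j) l i∉) , crossing-zeroʳ (_== j) (_== i) l i∉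
  where
  i∉ : ∀ a → a ∈ l → (a == i) ≡ false
  i∉ a a∈ = dec-false (a ≟ i) λ { refl → Unique[x∷xs]⇒x∉xs u a∈ }

-- By linearity in the first argument: the pair of `i` and `j` contributes 1, whereas `k` stands
-- after `j` and contributes nothing.
crossing-between : ∀ {i j k l} → Unique l → (i ∷ j ∷ k ∷ []) ⊑ l →
  crossing (λ a → (a == i) xor (a == k)) (_== j) l ≡ true
crossing-between {i} {j} {k} {l} u s =
  trans (crossing-xorˡ (_== i) (_== k) (_== j) l)
        (cong₂ _xor_ (proj₁ (crossing-ordered u (⊑-trans (refl ∷ refl ∷ k ∷ʳ []) s)))
                     (proj₂ (crossing-ordered u (⊑-trans (i ∷ʳ refl ∷ refl ∷ []) s))))

-- Sweeps

opp-opp : ∀ X → opp (opp X) ≡ X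
opp-opp west = refl
opp-opp east = refl

At : Side → Graph → ℕ → ℕ → Set
At X G x a = a ∈ A G × end X G a ≡ x

-- A positive form of `IsInnerVertex`: some edge leaves `x` and some edge enters it. In a D-graph
-- the two notions agree.
Inner : Graph → ℕ → Set
Inner G x = ∀ X → ∃ λ a → At X G x a

inner : ∀ X {G x a b} → At X G x a → At (opp X) G x b → Inner G x
inner west at-a at-b west = _ , at-a
inner west at-a at-b east = _ , at-b
inner east at-a at-b west = _ , at-b
inner east at-a at-b east = _ , at-a

Inner⇒¬IsVertexOf : ∀ X {G x} → Inner G x → ¬ IsVertexOf X G x
Inner⇒¬IsVertexOf X i (_ , no-edge) with i (opp X)
... | a , a∈ , eq = no-edge a a∈ eq

SameStar : Graph → Graph → ℕ → Set
SameStar G H x = ∀ X a → (At X G x a → At X H x a) × (At X H x a → At X G x a)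

some-∈ : ∀ {l : List ℕ} → l ≢ [] → ∃ λ b → b ∈ l
some-∈ {[]} l≢[] = contradiction refl l≢[]
some-∈ {b ∷ l} l≢[] = b , here refl

∈⇒≢[] : ∀ {a} {l : List ℕ} → a ∈ l → l ≢ []
∈⇒≢[] () refl

-- The orders in which `I` and `O` list the edges at `x` are free; a drawing chooses them. Both
-- being non-empty makes `x` inner and gives each factor a definite place in a slice.
record Star (G : Graph) (x : ℕ) (I O : List ℕ) : Set where
  field
    ins   : I Enumerates At east G x
    outs  : O Enumerates At west G x
    ins≢  : I ≢ []
    outs≢ : O ≢ []

open Star

Star⇒Inner : ∀ {G x I O} → Star G x I O → Inner G x
Star⇒Inner s west with some-∈ (outs≢ s)
... | a , a∈ = a , proj₁ (proj₂ (outs s)) a a∈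
Star⇒Inner s east with some-∈ (ins≢ s)
... | a , a∈ = a , proj₁ (proj₂ (ins s)) a a∈

Star-transfer : ∀ {G H x I O} → SameStar G H x → Star G x I O → Star H x I O
Star-transfer same s = record
  { ins = Enumerates-resp (λ a → proj₁ (same east a)) (λ a → proj₂ (same east a)) (ins s)
  ; outs = Enumerates-resp (λ a → proj₁ (same west a)) (λ a → proj₂ (same west a)) (outs s)
  ; ins≢ = ins≢ s ; outs≢ = outs≢ s }

data Step (G : Graph) (x : ℕ) (σ τ : List ℕ) : Set where
  step : ∀ Φ I O Ψ → Star G x I O → σ ≡ Φ ++ I ++ Ψ → τ ≡ Φ ++ O ++ Ψ → Step G x σ τ

data Sweep (G : Graph) : List ℕ → List ℕ → List ℕ → Set where
  []  : ∀ {σ} → Sweep G σ [] σ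
  _∷_ : ∀ {σ ρ τ x xs} → Step G x σ ρ → Sweep G ρ xs τ → Sweep G σ (x ∷ xs) τ

_⊕_ : ∀ {G σ ρ τ xs ys} → Sweep G σ xs ρ → Sweep G ρ ys τ → Sweep G σ (xs ++ ys) τ
[] ⊕ s = s
(st ∷ r) ⊕ s = st ∷ (r ⊕ s)

Sweep-transfer : ∀ {G H σ xs τ} → (∀ x → x ∈ xs → SameStar G H x) → Sweep G σ xs τ → Sweep H σ xs τ
Sweep-transfer same [] = []
Sweep-transfer same (step Φ I O Ψ st eqσ eqτ ∷ s) =
  step Φ I O Ψ (Star-transfer (same _ (here refl)) st) eqσ eqτ ∷
  Sweep-transfer (λ x x∈ → same x (there x∈)) s

reframe : ∀ (Λ Φ I Ψ Π : List ℕ) → Λ ++ (Φ ++ I ++ Ψ) ++ Π ≡ (Λ ++ Φ) ++ I ++ (Ψ ++ Π)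
reframe Λ Φ I Ψ Π = begin
  Λ ++ (Φ ++ I ++ Ψ) ++ Π    ≡⟨ cong (Λ ++_) (++-assoc Φ (I ++ Ψ) Π) ⟩
  Λ ++ Φ ++ (I ++ Ψ) ++ Π    ≡⟨ cong (λ z → Λ ++ Φ ++ z) (++-assoc I Ψ Π) ⟩
  Λ ++ Φ ++ I ++ Ψ ++ Π      ≡⟨ sym (++-assoc Λ Φ _) ⟩
  (Λ ++ Φ) ++ I ++ (Ψ ++ Π)  ∎ where open ≡-Reasoning

-- The edges of `Λ` and `Π` run idly along both sides of the sweep.
Sweep-frame : ∀ {G σ xs τ} Λ Π → Sweep G σ xs τ → Sweep G (Λ ++ σ ++ Π) xs (Λ ++ τ ++ Π)
Sweep-frame Λ Π [] = []
Sweep-frame Λ Π (step Φ I O Ψ st refl refl ∷ s) =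
  step (Λ ++ Φ) I O (Ψ ++ Π) st (reframe Λ Φ I Ψ Π) (reframe Λ Φ O Ψ Π) ∷ Sweep-frame Λ Π s

Sweep⇒Inner : ∀ {G σ xs τ} → Sweep G σ xs τ → ∀ x → x ∈ xs → Inner G x
Sweep⇒Inner (step Φ I O Ψ st _ _ ∷ s) x (here refl) = Star⇒Inner st
Sweep⇒Inner (_ ∷ s) x (there x∈) = Sweep⇒Inner s x x∈

Sweep-edges : ∀ {G σ xs τ} → Sweep G σ xs τ → (∀ a → a ∈ σ → a ∈ A G) → ∀ a → a ∈ τ → a ∈ A G
Sweep-edges [] h = h
Sweep-edges {G} (step Φ I O Ψ st refl refl ∷ s) h = Sweep-edges s h′
  where
  h′ : ∀ a → a ∈ Φ ++ O ++ Ψ → a ∈ A G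
  h′ a a∈ with ∈-++⁻ Φ a∈
  ... | inj₁ a∈Φ = h a (∈-++⁺ˡ a∈Φ)
  ... | inj₂ a∈′ with ∈-++⁻ O a∈′
  ...   | inj₁ a∈O = proj₁ (proj₁ (proj₂ (outs st)) a a∈O)
  ...   | inj₂ a∈Ψ = h a (∈-++⁺ʳ Φ (∈-++⁺ʳ I a∈Ψ))

-- With no edge from `x` to `y`, the edges produced at `x` and those consumed at `y` are disjoint
-- factors of the middle slice. One lies wholly to the left of the other, so the two steps act at
-- separate places.
Step-swap : ∀ {G x y σ ρ τ} → (∀ a → a ∈ A G → W G a ≡ x → E G a ≢ y) →
  Step G x σ ρ → Step G y ρ τ → ∃ λ ρ′ → Step G y σ ρ′ × Step G x ρ′ τ
Step-swap {G} no-edge (step Φ I O Ψ st refl refl) (step Φ′ I′ O′ Ψ′ st′ eq refl)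
  with factors-ordered Φ Φ′ O∩I′ (outs≢ st) (ins≢ st′) eq
  where
  O∩I′ : ∀ a → a ∈ O → a ∉ I′
  O∩I′ a a∈O a∈I′ with proj₁ (proj₂ (outs st)) a a∈O | proj₁ (proj₂ (ins st′)) a a∈I′
  ... | a∈A , Wa | _ , Ea = no-edge a a∈A Wa Ea
... | inj₁ (Θ , refl , refl) =
  Φ′ ++ O′ ++ Θ ++ I ++ Ψ ,
  step Φ′ I′ O′ (Θ ++ I ++ Ψ) st′ (assoc I′ (I ++ Ψ)) refl ,
  step (Φ′ ++ O′ ++ Θ) I O Ψ st (sym (assoc O′ (I ++ Ψ))) (sym (assoc O′ (O ++ Ψ)))
  where
  assoc : ∀ (J K : List ℕ) → (Φ′ ++ J ++ Θ) ++ K ≡ Φ′ ++ J ++ Θ ++ K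
  assoc J K = trans (++-assoc Φ′ (J ++ Θ) K) (cong (Φ′ ++_) (++-assoc J Θ K))
... | inj₂ (Θ , refl , refl) =
  Φ ++ I ++ Θ ++ O′ ++ Ψ′ ,
  step (Φ ++ I ++ Θ) I′ O′ Ψ′ st′ (sym (assoc I (I′ ++ Ψ′))) (sym (assoc I (O′ ++ Ψ′))) ,
  step Φ I O (Θ ++ O′ ++ Ψ′) st refl (assoc O (O′ ++ Ψ′))
  where
  assoc : ∀ (J K : List ℕ) → (Φ ++ J ++ Θ) ++ K ≡ Φ ++ J ++ Θ ++ K
  assoc J K = trans (++-assoc Φ (J ++ Θ) K) (cong (Φ ++_) (++-assoc J Θ K))

Step-delay : ∀ {G x ys σ ρ τ} → (∀ a → a ∈ A G → W G a ≡ x → E G a ∉ ys) →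
  Step G x σ ρ → Sweep G ρ ys τ → ∃ λ ρ′ → Sweep G σ ys ρ′ × Step G x ρ′ τ
Step-delay no-edge st [] = _ , [] , st
Step-delay no-edge st (st′ ∷ s)
  with Step-swap (λ a a∈ Wa Ea → no-edge a a∈ Wa (here Ea)) st st′
... | _ , st₁ , st₂ with Step-delay (λ a a∈ Wa Ea → no-edge a a∈ Wa (there Ea)) st₂ s
... | ρ′ , s′ , st₃ = ρ′ , st₁ ∷ s′ , st₃

-- An insertion sort: once the rest is sorted, a first vertex outside `U` is delayed past the
-- vertices of `U`. This is possible because no edge enters `U` from outside.
Sweep-sort : ∀ {G σ xs τ} U → (∀ a → a ∈ A G → E G a ∈ U → W G a ∈ U) → Sweep G σ xs τ →
  ∃ λ ρ → Sweep G σ (filter (_∈? U) xs) ρ × Sweep G ρ (filter (λ x → ¬? (x ∈? U)) xs) τ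
Sweep-sort U closed [] = _ , [] , []
Sweep-sort {G} U closed (_∷_ {x = x} {xs} st s) with Sweep-sort U closed s
... | ρ , s₁ , s₂ with x ∈? U
... | yes x∈ = ρ , st ∷ s₁ , s₂
... | no x∉
  with Step-delay (λ a a∈ Wa Ea →
         x∉ (subst (_∈ U) Wa (closed a a∈ (proj₂ (∈-filter⁻ (_∈? U) {xs = xs} Ea))))) st s₁
... | ρ′ , s₁′ , st′ = ρ′ , s₁′ , st′ ∷ s₂

mult-Enumerates : ∀ {a x X G I} → I Enumerates At X G x → a ∈ A G → mult a I ≡ mult (end X G a) (x ∷ [])
mult-Enumerates {a} {x} {X} {G} (u , s , c) a∈ with end X G a ≟ x
... | yes eq = trans (mult-∈ u (c a (a∈ , eq))) (sym (mult-∈ ([] ∷ []) (here eq)))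
... | no ¬eq = trans (mult-∉ λ a∈I → ¬eq (proj₂ (s a a∈I)))
                      (sym (mult-∉ {end X G a} {x ∷ []} λ { (here eq) → ¬eq eq }))

-- A conservation law: sweeping over the west end of `a` adds a copy of `a` to the slice, and
-- sweeping over its east end removes one. Its additive form avoids subtraction.
Sweep-mult : ∀ {G σ xs τ} → Sweep G σ xs τ → ∀ a → a ∈ A G →
  mult a τ + mult (E G a) xs ≡ mult a σ + mult (W G a) xs
Sweep-mult [] a a∈ = refl
Sweep-mult {G} {τ = τ} (_∷_ {x = x} {xs} (step Φ I O Ψ st refl refl) s) a a∈ =
  trans (cong (mult a τ +_) (mult-++ (E G a) (x ∷ []) xs))
  (trans (lemma₁ (mult a τ) (mult (E G a) (x ∷ [])) (mult (E G a) xs))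
  (trans (cong (mult (E G a) (x ∷ []) +_) (Sweep-mult s a a∈))
  (trans (cong₂ (λ y z → y + (z + mult (W G a) xs)) (sym (mult-Enumerates {X = east} {G} (ins st) a∈)) (m₃ O))
  (trans (lemma₂ (mult a I) (mult a Φ) (mult a O) (mult a Ψ) (mult (W G a) xs))
  (cong₂ (λ y z → y + z) (sym (m₃ I))
    (trans (cong (_+ mult (W G a) xs) (mult-Enumerates {X = west} {G} (outs st) a∈))
           (sym (mult-++ (W G a) (x ∷ []) xs))))))))
  where
  m₃ : ∀ J → mult a (Φ ++ J ++ Ψ) ≡ mult a Φ + (mult a J + mult a Ψ)
  m₃ J = trans (mult-++ a Φ (J ++ Ψ)) (cong (mult a Φ +_) (mult-++ a J Ψ))
  lemma₁ : ∀ t e r → t + (e + r) ≡ e + (t + r)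
  lemma₁ = solve-∀
  lemma₂ : ∀ i f o p w → i + ((f + (o + p)) + w) ≡ (f + (i + p)) + (o + w)
  lemma₂ = solve-∀

-- By `crossing-++`, the surroundings of a factor see it only through these three bits.
Neutral : (ℕ → Bool) → (ℕ → Bool) → List ℕ → List ℕ → Set
Neutral p q I O =
  parity p I ≡ parity p O × parity q I ≡ parity q O × crossing p q I ≡ crossing p q O

crossing-replace : ∀ {p q} Φ I O Ψ → Neutral p q I O →
  crossing p q (Φ ++ I ++ Ψ) ≡ crossing p q (Φ ++ O ++ Ψ)
crossing-replace {p} {q} Φ I O Ψ (hp , hq , hc) =
  trans (crossing-++ p q Φ (I ++ Ψ))
  (trans (cong₂ (λ y z → (crossing p q Φ xor y) xor (parity p Φ ∧ z)) eq₁ eq₂)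
         (sym (crossing-++ p q Φ (O ++ Ψ))))
  where
  eq₁ : crossing p q (I ++ Ψ) ≡ crossing p q (O ++ Ψ)
  eq₁ = trans (crossing-++ p q I Ψ)
        (trans (cong₂ (λ y z → (y xor crossing p q Ψ) xor (z ∧ parity q Ψ)) hc hp)
               (sym (crossing-++ p q O Ψ)))
  eq₂ : parity q (I ++ Ψ) ≡ parity q (O ++ Ψ)
  eq₂ = trans (parity-++ q I Ψ) (trans (cong (_xor parity q Ψ) hq) (sym (parity-++ q O Ψ)))

Sweep-crossing : ∀ {G σ xs τ p q} → (∀ {x I O} → x ∈ xs → Star G x I O → Neutral p q I O) →
  Sweep G σ xs τ → crossing p q σ ≡ crossing p q τ
Sweep-crossing neutral [] = refl
Sweep-crossing neutral (step Φ I O Ψ st refl refl ∷ s) =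
  trans (crossing-replace Φ I O Ψ (neutral (here refl) st))
        (Sweep-crossing (λ x∈ → neutral (there x∈)) s)

Vanishes : (ℕ → Bool) → List ℕ → Set
Vanishes p l = ∀ a → a ∈ l → p a ≡ false

-- If one of the two sets has no edge at the vertex, the crossing numbers of `I` and `O` are both 0.
neutral-disjoint : ∀ {p q I O} → parity p I ≡ parity p O → parity q I ≡ parity q O →
  (Vanishes p I × Vanishes p O) ⊎ (Vanishes q I × Vanishes q O) → Neutral p q I O
neutral-disjoint {p} {q} {I} {O} hp hq (inj₁ (pI , pO)) =
  hp , hq , trans (crossing-zeroˡ p q I pI) (sym (crossing-zeroˡ p q O pO))
neutral-disjoint {p} {q} {I} {O} hp hq (inj₂ (qI , qO)) =
  hp , hq , trans (crossing-zeroʳ p q I qI) (sym (crossing-zeroʳ p q O qO))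

-- Trails

-- Vertices and edges may repeat. Only the edge list is recorded, since just the degrees modulo 2
-- matter.
data Trail (G : Graph) : ℕ → List ℕ → ℕ → Set where
  []  : ∀ {u} → Trail G u [] u
  via : ∀ {u v w a es} → a ∈ A G → Joins G a u v → Trail G v es w → Trail G u (a ∷ es) w

-- The number of occurrences modulo 2, so that an edge traversed twice counts as absent.
occ : List ℕ → ℕ → Bool
occ [] a = false
occ (b ∷ es) a = (a == b) xor occ es a

occ-∉ : ∀ {a} es → a ∉ es → occ es a ≡ false
occ-∉ [] a∉ = refl
occ-∉ {a} (b ∷ es) a∉ =
  cong₂ _xor_ (dec-false (a ≟ b) λ eq → a∉ (here eq)) (occ-∉ es λ a∈ → a∉ (there a∈))

Trail-edges : ∀ {G u es v} → Trail G u es v → ∀ a → a ∈ es → a ∈ A G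
Trail-edges (via b∈ _ t) a (here refl) = b∈
Trail-edges (via b∈ _ t) a (there a∈) = Trail-edges t a a∈

_∷ʳᵗ_ : ∀ {G u es v w a} → Trail G u es v → a ∈ A G × Joins G a v w →
        ∃ λ es′ → Trail G u es′ w
[] ∷ʳᵗ (a∈ , j) = _ , via a∈ j []
via b∈ j t ∷ʳᵗ e with t ∷ʳᵗ e
... | _ , t′ = _ , via b∈ j t′

Linked⇒Trail : ∀ {G} u s → Linked G u s → Trail G u (map proj₁ s) (lastV u s)
Linked⇒Trail u [] _ = []
Linked⇒Trail u ((a , v) ∷ s) (a∈ , _ , j , l) = via a∈ j (Linked⇒Trail v s l)

Joins-end : ∀ {G a u v} X → Joins G a u v → end X G a ≡ u ⊎ end X G a ≡ v
Joins-end west (inj₁ (p , _)) = inj₁ p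
Joins-end west (inj₂ (_ , p)) = inj₂ p
Joins-end east (inj₁ (_ , p)) = inj₂ p
Joins-end east (inj₂ (p , _)) = inj₁ p

-- Both ends of each edge of a semipath are among its vertices.
Linked-avoids : ∀ {G x} u s → Linked G u s → x ∉ u ∷ map proj₂ s →
  ∀ X a → At X G x a → a ∉ map proj₁ s
Linked-avoids {G} u ((b , v) ∷ s) (_ , _ , j , l) x∉ X a (_ , eq) (here refl)
  with Joins-end {G} X j
... | inj₁ eq′ = x∉ (here (trans (sym eq) eq′))
... | inj₂ eq′ = x∉ (there (here (trans (sym eq) eq′)))
Linked-avoids u ((b , v) ∷ s) (_ , _ , j , l) x∉ X a at (there a∈) =
  Linked-avoids v s l (λ x∈ → x∉ (there x∈)) X a at a∈

parity-Enumerates : ∀ X {G x l b} → l Enumerates At X G x → b ∈ A G →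
  parity (_== b) l ≡ (x == end X G b)
parity-Enumerates X {G} {x} {l} {b} (u , s , c) b∈ = helper (end X G b ≟ x)
  where
  helper : Dec (end X G b ≡ x) → parity (_== b) l ≡ (x == end X G b)
  helper (yes eq) = trans (parity-single-∈ u (c b (b∈ , eq))) (sym (dec-true (x ≟ end X G b) (sym eq)))
  helper (no ¬eq) = trans (parity-single-∉ λ b∈l → ¬eq (proj₂ (s b b∈l)))
                          (sym (dec-false (x ≟ end X G b) λ eq → ¬eq (sym eq)))

-- The left side is the degree of `x` in the trail modulo 2. Each traversed edge contributes at its
-- two ends, and the contributions of successive edges telescope, leaving the two ends of the trail.
Trail-degree : ∀ {G u es v x I O} → I Enumerates At east G x → O Enumerates At west G x →
  Trail G u es v → parity (occ es) I xor parity (occ es) O ≡ (x == u) xor (x == v)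
Trail-degree {u = u} {x = x} {I} {O} eI eO []
  rewrite parity-false (occ []) {I} (λ _ _ → refl) | parity-false (occ []) {O} (λ _ _ → refl) =
  sym (xor-same (x == u))
Trail-degree {G} {u} {b ∷ es} {v} {x} {I} {O} eI eO (via {v = w} b∈ j t) =
  trans (cong₂ _xor_ (parity-xor (_== b) (occ es) I) (parity-xor (_== b) (occ es) O))
  (trans (cong₂ (λ y z → (y xor parity (occ es) I) xor (z xor parity (occ es) O))
                (parity-Enumerates east {G} eI b∈) (parity-Enumerates west {G} eO b∈))
  (trans (xor-interchange (x == E G b) (parity (occ es) I) (x == W G b) (parity (occ es) O))
  (trans (cong (((x == E G b) xor (x == W G b)) xor_) (Trail-degree eI eO t))
         (ends j))))
  where
  cancel : ∀ y z c → (y xor z) xor (y xor c) ≡ z xor c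
  cancel y z c = trans (xor-interchange y z y c) (cong (_xor (z xor c)) (xor-same y))
  ends : Joins G b u w →
    ((x == E G b) xor (x == W G b)) xor ((x == w) xor (x == v)) ≡ (x == u) xor (x == v)
  ends (inj₁ (refl , refl)) = cancel (x == E G b) (x == W G b) (x == v)
  ends (inj₂ (refl , refl)) =
    trans (cong (_xor ((x == W G b) xor (x == v))) (xor-comm (x == E G b) (x == W G b)))
          (cancel (x == W G b) (x == E G b) (x == v))

xor≡false⇒≡ : ∀ a b → a xor b ≡ false → a ≡ b
xor≡false⇒≡ false b eq = sym eq
xor≡false⇒≡ true true eq = refl

-- Away from its ends a trail has even degree, and modulo 2 this means that its in-degree equals its
-- out-degree.
Trail-balanced : ∀ {G u es v x I O} → Star G x I O → x ≢ u → x ≢ v → Trail G u es v →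
  parity (occ es) I ≡ parity (occ es) O
Trail-balanced {u = u} {v = v} {x} st x≢u x≢v t =
  xor≡false⇒≡ _ _ (trans (Trail-degree (ins st) (outs st) t)
    (cong₂ _xor_ (dec-false (x ≟ u) x≢u) (dec-false (x ≟ v) x≢v)))

-- The `X`-end of `a` has degree one. This is functionality for a single edge, to be checked on the
-- slice edges of a piece.
Pendant : Side → Graph → ℕ → Set
Pendant X G a = IsEdgeOf X G a × (∀ b → b ∈ A G → end X G b ≡ end X G a → b ≡ a)

-- At a vertex whose only edge is `a`, the degree of the trail is just `occ es a`, so `Trail-degree`
-- determines it.
Trail-pendant : ∀ X {G u es v a} → Pendant X G a → Trail G u es v →
  occ es a ≡ (end X G a == u) xor (end X G a == v)
Trail-pendant X {G} {u} {es} {v} {a} ((a∈ , _ , none) , unique) t = go X none unique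
  where
  single : ∀ Y → (∀ b → b ∈ A G → end Y G b ≡ end Y G a → b ≡ a) →
           (a ∷ []) Enumerates At Y G (end Y G a)
  single Y unique = ([] ∷ []) , (λ { _ (here refl) → a∈ , refl }) ,
                    (λ b → λ { (b∈ , eq) → here (unique b b∈ eq) })
  empty : ∀ Y {x} → (∀ b → b ∈ A G → end Y G b ≢ x) → [] Enumerates At Y G x
  empty Y none = [] , (λ _ ()) , (λ b → λ { (b∈ , eq) → contradiction eq (none b b∈) })
  go : ∀ Y → (∀ b → b ∈ A G → end (opp Y) G b ≢ end Y G a) →
       (∀ b → b ∈ A G → end Y G b ≡ end Y G a → b ≡ a) →
       occ es a ≡ (end Y G a == u) xor (end Y G a == v)
  go west none unique =
    trans (sym (xor-identityʳ _)) (Trail-degree (empty east none) (single west unique) t)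
  go east none unique =
    trans (sym (trans (xor-identityʳ _) (xor-identityʳ _)))
          (Trail-degree (single east unique) (empty west none) t)

-- A sweep between σ and τ, where σ is the slice on the side X.

SweepAway : Side → Graph → List ℕ → List ℕ → List ℕ → Set
SweepAway west G σ xs τ = Sweep G σ xs τ
SweepAway east G σ xs τ = Sweep G τ xs σ

SweepAway-crossing : ∀ X {G σ xs τ p q} →
  (∀ {x I O} → x ∈ xs → Star G x I O → Neutral p q I O) →
  SweepAway X G σ xs τ → crossing p q σ ≡ crossing p q τ
SweepAway-crossing west neutral s = Sweep-crossing neutral s
SweepAway-crossing east neutral s = sym (Sweep-crossing neutral s)

-- The crossing argument in one piece

-- Here `G` is a piece swept from the cut slice `σ` to the outer slice `τ`. Both slices may contain
-- edges outside `G`, so the pendant conditions are restricted to edges of `G`.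
record Half (X : Side) (G : Graph) (σ xs τ : List ℕ) : Set where
  field
    unique    : Unique σ
    sweep     : SweepAway X G σ xs τ
    pendant-σ : ∀ a → a ∈ σ → a ∈ A G → Pendant X G a
    pendant-τ : ∀ a → a ∈ τ → a ∈ A G → Pendant (opp X) G a

module _ {X : Side} {G : Graph} {σ xs τ : List ℕ} (H : Half X G σ xs τ) where
  open Half H

  private
    e : ℕ → ℕ
    e = end X G

  e-== : ∀ {a i} → i ∈ σ → i ∈ A G → a ∈ A G → (e a == e i) ≡ (a == i)
  e-== {a} {i} i∈σ i∈ a∈ = helper (a ≟ i)
    where
    helper : Dec (a ≡ i) → (e a == e i) ≡ (a == i)
    helper (yes refl) = trans (dec-true (e a ≟ e a) refl) (sym (dec-true (a ≟ a) refl))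
    helper (no a≢i) =
      trans (dec-false (e a ≟ e i) λ eq → a≢i (proj₂ (pendant-σ i i∈σ i∈) a a∈ eq))
            (sym (dec-false (a ≟ i) a≢i))

  end-vertex : ∀ {i} → i ∈ σ → i ∈ A G → IsVertexOf X G (e i)
  end-vertex i∈σ i∈ = proj₂ (proj₁ (pendant-σ _ i∈σ i∈))

  -- Edges of `G` in `σ` are pendant, so the trail uses such an edge an odd number of times just
  -- when it begins or ends there. Edges outside `G` lie on no trail of `G`.
  between-on-σ : ∀ {i k es} → i ∈ σ → i ∈ A G → k ∈ σ → k ∈ A G → Trail G (e i) es (e k) →
    ∀ a → a ∈ σ → occ es a ≡ (a == i) xor (a == k)
  between-on-σ {i} {k} {es} i∈σ i∈ k∈σ k∈ t a a∈σ with a ∈? A G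
  ... | yes a∈ = trans (Trail-pendant X (pendant-σ a a∈σ a∈) t)
                       (cong₂ _xor_ (e-== i∈σ i∈ a∈) (e-== k∈σ k∈ a∈))
  ... | no a∉ = trans (occ-∉ es λ a∈ → a∉ (Trail-edges t a a∈))
                (sym (cong₂ _xor_ (dec-false (a ≟ i) λ { refl → a∉ i∈ })
                                  (dec-false (a ≟ k) λ { refl → a∉ k∈ })))

  -- Both ends of the trail are `X`-vertices, hence differ from the ends on the other side at which
  -- the edges of `τ` are pendant.
  between-on-τ : ∀ {i k es} → i ∈ σ → i ∈ A G → k ∈ σ → k ∈ A G → Trail G (e i) es (e k) →
    Vanishes (occ es) τ
  between-on-τ {i} {k} {es} i∈σ i∈ k∈σ k∈ t a a∈τ with a ∈? A G
  ... | yes a∈ = trans (Trail-pendant (opp X) (pendant-τ a a∈τ a∈) t)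
                       (cong₂ _xor_ (dec-false (_ ≟ e i) (proj₂ (end-vertex i∈σ i∈) a a∈))
                                    (dec-false (_ ≟ e k) (proj₂ (end-vertex k∈σ k∈) a a∈)))
  ... | no a∉ = occ-∉ es λ a∈ → a∉ (Trail-edges t a a∈)

  between-balanced : ∀ {i k es x I O} → i ∈ σ → i ∈ A G → k ∈ σ → k ∈ A G →
    Trail G (e i) es (e k) → Star G x I O → parity (occ es) I ≡ parity (occ es) O
  between-balanced i∈σ i∈ k∈σ k∈ t st = Trail-balanced st
    (λ { refl → Inner⇒¬IsVertexOf X (Star⇒Inner st) (end-vertex i∈σ i∈) })
    (λ { refl → Inner⇒¬IsVertexOf X (Star⇒Inner st) (end-vertex k∈σ k∈) }) t

  -- The far end `z` lies on the opposite side, so it is the `X`-end of no edge, and only the start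
  -- of the trail shows on `σ`.
  across-on-σ : ∀ {j z es} → j ∈ σ → j ∈ A G → IsVertexOf (opp X) G z → Trail G (e j) es z →
    ∀ a → a ∈ σ → occ es a ≡ (a == j)
  across-on-σ {j} {z} {es} j∈σ j∈ (_ , none) t a a∈σ with a ∈? A G
  ... | yes a∈ = trans (Trail-pendant X (pendant-σ a a∈σ a∈) t)
                 (trans (cong₂ _xor_ (e-== j∈σ j∈ a∈) (dec-false (e a ≟ z) a≢z)) (xor-identityʳ _))
    where
    a≢z : e a ≢ z
    a≢z = subst (λ Y → end Y G a ≢ z) (opp-opp X) (none a a∈)
  ... | no a∉ = trans (occ-∉ es λ a∈ → a∉ (Trail-edges t a a∈)) (sym (dec-false (a ≟ j) λ { refl → a∉ j∈ }))

  across-balanced : ∀ {j z es x I O} → j ∈ σ → j ∈ A G → IsVertexOf (opp X) G z →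
    Trail G (e j) es z → Star G x I O → parity (occ es) I ≡ parity (occ es) O
  across-balanced j∈σ j∈ z-vertex t st = Trail-balanced st
    (λ { refl → Inner⇒¬IsVertexOf X (Star⇒Inner st) (end-vertex j∈σ j∈) })
    (λ { refl → Inner⇒¬IsVertexOf (opp X) (Star⇒Inner st) z-vertex }) t

  -- The crossing number of the trail with `q` is 1 on `σ`, where `q` is just `j`, and 0 on `τ`,
  -- which the trail does not reach; yet the sweep preserves it. The set `q` is left abstract to
  -- cover both a semipath of `G` and a single edge outside `G`.
  not-separated : ∀ {i j k es q} → (i ∷ j ∷ k ∷ []) ⊑ σ → i ∈ A G → k ∈ A G →
    Trail G (e i) es (e k) ⊎ Trail G (e k) es (e i) → (∀ a → a ∈ σ → q a ≡ (a == j)) →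
    (∀ {x I O} → x ∈ xs → Star G x I O → parity q I ≡ parity q O ×
      ((Vanishes (occ es) I × Vanishes (occ es) O) ⊎ (Vanishes q I × Vanishes q O))) → ⊥
  not-separated {i} {j} {k} {es} {q} s i∈ k∈ t q-σ q-neutral = true≢false (begin
    true                                            ≡⟨ crossing-between unique s ⟨
    crossing (λ a → (a == i) xor (a == k)) (_== j) σ  ≡⟨ crossing-cong σ (on-σ t) q-σ ⟨
    crossing (occ es) q σ  ≡⟨ SweepAway-crossing X (λ x∈ st → neutral-disjoint (balanced t st)
                                (proj₁ (q-neutral x∈ st)) (proj₂ (q-neutral x∈ st))) sweep ⟩
    crossing (occ es) q τ  ≡⟨ crossing-zeroˡ (occ es) q τ (on-τ t) ⟩
    false ∎)
    where
    open ≡-Reasoning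
    true≢false : true ≢ false
    true≢false ()
    i∈σ : i ∈ σ
    i∈σ = ⊑-lookup s (here refl)
    k∈σ : k ∈ σ
    k∈σ = ⊑-lookup s (there (there (here refl)))
    on-σ : Trail G (e i) es (e k) ⊎ Trail G (e k) es (e i) →
           ∀ a → a ∈ σ → occ es a ≡ (a == i) xor (a == k)
    on-σ (inj₁ t) = between-on-σ i∈σ i∈ k∈σ k∈ t
    on-σ (inj₂ t) a a∈ = trans (between-on-σ k∈σ k∈ i∈σ i∈ t a a∈) (xor-comm (a == k) (a == i))
    on-τ : Trail G (e i) es (e k) ⊎ Trail G (e k) es (e i) → Vanishes (occ es) τ
    on-τ (inj₁ t) = between-on-τ i∈σ i∈ k∈σ k∈ t
    on-τ (inj₂ t) = between-on-τ k∈σ k∈ i∈σ i∈ t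
    balanced : Trail G (e i) es (e k) ⊎ Trail G (e k) es (e i) →
      ∀ {x I O} → Star G x I O → parity (occ es) I ≡ parity (occ es) O
    balanced (inj₁ t) = between-balanced i∈σ i∈ k∈σ k∈ t
    balanced (inj₂ t) = between-balanced k∈σ k∈ i∈σ i∈ t

  -- An edge outside G in the slice is a strand which no trail of G can cross.

  no-strand-between : ∀ {i j k es} → (i ∷ j ∷ k ∷ []) ⊑ σ → i ∈ A G → k ∈ A G → j ∉ A G →
    ¬ Trail G (e i) es (e k)
  no-strand-between {j = j} s i∈ k∈ j∉ t =
    not-separated s i∈ k∈ (inj₁ t) (λ _ _ → refl) λ x∈ st →
      trans (parity-false (_== j) (vI st)) (sym (parity-false (_== j) (vO st))) , inj₂ (vI st , vO st)
    where
    vI : ∀ {x I O} → Star G x I O → Vanishes (_== j) I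
    vI st a a∈ = dec-false (a ≟ j) λ { refl → j∉ (proj₁ (proj₁ (proj₂ (ins st)) a a∈)) }
    vO : ∀ {x I O} → Star G x I O → Vanishes (_== j) O
    vO st a a∈ = dec-false (a ≟ j) λ { refl → j∉ (proj₁ (proj₁ (proj₂ (outs st)) a a∈)) }

  -- Meeting is decidable. If `p` and `q` had no common vertex, each swept vertex would be missed by
  -- one of them, so the crossing number of their edge sets would be preserved, against
  -- `not-separated`.
  semipaths-meet : ∀ {i j k} → (i ∷ j ∷ k ∷ []) ⊑ σ → i ∈ A G → j ∈ A G → k ∈ A G →
    (p : Semipath G) → InSP G p (e i) (e k) ⊎ InSP G p (e k) (e i) →
    (q : Semipath G) → InSPX G q (e j) (opp X) → ∃ λ x → x ∈ spVerts p × x ∈ spVerts q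
  semipaths-meet {i} {j} {k} s i∈ j∈ k∈ p p-ends q (q-start , z-vertex)
    with All.all? (λ x → ¬? (x ∈? spVerts q)) (spVerts p)
  ... | no ¬disjoint with find (¬All⇒Any¬ (λ x → ¬? (x ∈? spVerts q)) (spVerts p) ¬disjoint)
  ...   | x , x∈p , ¬¬x∈q = x , x∈p , decidable-stable (x ∈? spVerts q) ¬¬x∈q
  semipaths-meet {i} {j} {k} s i∈ j∈ k∈ p p-ends q (q-start , z-vertex) | yes disjoint =
    ⊥-elim (not-separated s i∈ k∈ p-trail (across-on-σ j∈σ j∈ z-vertex q-trail)
      λ {x} x∈ st → across-balanced j∈σ j∈ z-vertex q-trail st , avoid x st)
    where
    j∈σ : j ∈ σ
    j∈σ = ⊑-lookup s (there (here refl))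
    es fs : List ℕ
    es = map proj₁ (steps p)
    fs = map proj₁ (steps q)
    p-trail : Trail G (e i) es (e k) ⊎ Trail G (e k) es (e i)
    p-trail = Sum.map cast cast p-ends
      where
      cast : ∀ {u v} → InSP G p u v → Trail G u es v
      cast (refl , refl) = Linked⇒Trail (start p) (steps p) (linked p)
    q-trail : Trail G (e j) fs (spEnd q)
    q-trail = subst (λ u → Trail G u fs (spEnd q)) q-start (Linked⇒Trail (start q) (steps q) (linked q))
    vanish : ∀ {Y l x} (r : Semipath G) → l Enumerates At Y G x → x ∉ spVerts r →
             Vanishes (occ (map proj₁ (steps r))) l
    vanish {Y} r (_ , at , _) x∉ a a∈ =
      occ-∉ (map proj₁ (steps r)) (Linked-avoids (start r) (steps r) (linked r) x∉ Y a (at a a∈))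
    avoid : ∀ x {I O} → Star G x I O →
      (Vanishes (occ es) I × Vanishes (occ es) O) ⊎ (Vanishes (occ fs) I × Vanishes (occ fs) O)
    avoid x st with x ∈? spVerts p
    ... | no x∉ = inj₁ (vanish {east} p (ins st) x∉ , vanish {west} p (outs st) x∉)
    ... | yes x∈p = inj₂ (vanish {east} q (ins st) x∉ , vanish {west} q (outs st) x∉)
      where
      x∉ : x ∉ spVerts q
      x∉ = All.lookup disjoint x∈p

  -- Three vertices in order on the list come from three edges in order on `σ`. The two required
  -- instances of `ψ` differ only in the direction of the semipath joining the outer two.
  grounded : Grounded X G (map e (filter (_∈? A G) σ))
  grounded v u w s with ⊑-map⁻ e (filter (_∈? A G) σ) s
  ... | i ∷ j ∷ k ∷ [] , s′ , refl =
    (λ p p-ends q → semipaths-meet (⊑-trans s′ filter-⊑) (inA (here refl)) (inA (there (here refl)))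
       (inA (there (there (here refl)))) p (inj₁ p-ends) q) ,
    (λ p p-ends q → semipaths-meet (⊑-trans s′ filter-⊑) (inA (here refl)) (inA (there (here refl)))
       (inA (there (there (here refl)))) p (inj₂ p-ends) q)
    where
    filter-⊑ : filter (_∈? A G) σ ⊑ σ
    filter-⊑ = filter-⊆ (_∈? A G) σ
    inA : ∀ {a} → a ∈ i ∷ j ∷ k ∷ [] → a ∈ A G
    inA a∈ = proj₂ (∈-filter⁻ (_∈? A G) {xs = σ} (⊑-lookup s′ a∈))

-- D-graphs

module _ {D : Graph} (d : IsDGraph D) where
  private
    well-formed : WellFormed D
    well-formed = proj₁ d
    acyclic : Acyclic D
    acyclic = proj₁ (proj₂ d)
    functional : WEFunctional D
    functional = proj₁ (proj₂ (proj₂ d))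
    connected : WeaklyConnected D
    connected = proj₁ (proj₂ (proj₂ (proj₂ d)))

  end∈V : ∀ X {a} → a ∈ A D → end X D a ∈ V D
  end∈V west a∈ = proj₁ (proj₂ (proj₂ well-formed) _ a∈)
  end∈V east a∈ = proj₂ (proj₂ (proj₂ well-formed) _ a∈)

  edge-at? : ∀ X v → (∃ λ a → At X D v a) ⊎ (∀ a → a ∈ A D → end X D a ≢ v)
  edge-at? X v with any? (λ a → end X D a ≟ v) (A D)
  ... | yes some with find some
  ...   | a , a∈ , eq = inj₁ (a , a∈ , eq)
  edge-at? X v | no none = inj₂ λ a a∈ eq → none (lose a∈ eq)

  -- The edge list is finite, so searching it turns the two negations into witnesses.
  IsInnerVertex⇒Inner : ∀ {v} → IsInnerVertex D v → Inner D v
  IsInnerVertex⇒Inner {v} (v∈ , ¬w , ¬e) west with edge-at? west v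
  ... | inj₁ at = at
  ... | inj₂ none = contradiction (v∈ , none) ¬e
  IsInnerVertex⇒Inner {v} (v∈ , ¬w , ¬e) east with edge-at? east v
  ... | inj₁ at = at
  ... | inj₂ none = contradiction (v∈ , none) ¬w

  Inner⇒∈V : ∀ {v} → Inner D v → v ∈ V D
  Inner⇒∈V i with i west
  ... | a , a∈ , refl = end∈V west a∈

  Inner⇒IsInnerVertex : ∀ {v} → Inner D v → IsInnerVertex D v
  Inner⇒IsInnerVertex i = Inner⇒∈V i , Inner⇒¬IsVertexOf west i , Inner⇒¬IsVertexOf east i

  trail : ∀ {u v} → u ∈ V D → v ∈ V D → ∃ λ es → Trail D u es v
  trail {u} {v} u∈ v∈ with connected u v u∈ v∈
  ... | p , refl , refl = _ , Linked⇒Trail (start p) (steps p) (linked p)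

  inner-exists : ∃ λ v → Inner D v
  inner-exists with proj₂ (proj₂ (proj₂ (proj₂ d)))
  ... | v , i = v , IsInnerVertex⇒Inner i

  -- Take a trail from `v` to an inner vertex: either it is empty and `v` is itself inner, or its
  -- first edge is at `v`.
  incident-edge : ∀ {v} → v ∈ V D → ∃ λ X → ∃ λ a → At X D v a
  incident-edge {v} v∈ with inner-exists
  ... | x , i with trail v∈ (Inner⇒∈V i)
  ... | _ , [] = west , i west
  ... | _ , via a∈ (inj₁ (eq , _)) _ = west , _ , a∈ , eq
  ... | _ , via a∈ (inj₂ (eq , _)) _ = east , _ , a∈ , eq

  edge-of-vertex : ∀ X {v} → IsVertexOf X D v → ∃ λ a → At X D v a
  edge-of-vertex X (v∈ , none) with incident-edge v∈
  edge-of-vertex west (v∈ , none) | west , at = at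
  edge-of-vertex east (v∈ , none) | east , at = at
  edge-of-vertex west (v∈ , none) | east , a , a∈ , eq = contradiction eq (none a a∈)
  edge-of-vertex east (v∈ , none) | west , a , a∈ , eq = contradiction eq (none a a∈)

  edge-unique : ∀ X {v a b} → IsVertexOf X D v → At X D v a → At X D v b → b ≡ a
  edge-unique X {a = a} {b} v-vertex (a∈ , refl) (b∈ , eq) with b ≟ a
  ... | yes b≡a = b≡a
  ... | no b≢a = contradiction eq (functional X a (a∈ , v-vertex) b b∈ b≢a)

  edges-of-vertices : ∀ X L → (∀ v → v ∈ L → IsVertexOf X D v) →
    ∃ λ σ → map (end X D) σ ≡ L × (∀ a → a ∈ σ → a ∈ A D)
  edges-of-vertices X [] h = [] , refl , λ _ ()
  edges-of-vertices X (v ∷ L) h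
    with edge-of-vertex X (h v (here refl)) | edges-of-vertices X L (λ u u∈ → h u (there u∈))
  ... | a , a∈ , refl | σ , refl , σ⊆ =
    a ∷ σ , refl , λ { _ (here refl) → a∈ ; b (there b∈) → σ⊆ b b∈ }

  -- By functionality each `X`-vertex carries a single edge, so listing the vertices amounts to
  -- listing the edges.
  boundary-Enumerates : ∀ X {σ L} → IsListOf X D L → map (end X D) σ ≡ L →
    (∀ a → a ∈ σ → a ∈ A D) → σ Enumerates IsEdgeOf X D
  boundary-Enumerates X {σ} (u , sound , complete) refl σ⊆ =
    map⁻ u , (λ a a∈ → σ⊆ a a∈ , sound _ (∈-map⁺ (end X D) a∈)) , complete′
    where
    complete′ : ∀ a → IsEdgeOf X D a → a ∈ σ
    complete′ a (a∈ , v-vertex) with ∈-map⁻ (end X D) (complete _ v-vertex)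
    ... | b , b∈σ , eq = subst (_∈ σ) (edge-unique X v-vertex (a∈ , refl) (σ⊆ b b∈σ , sym eq)) b∈σ

  -- Otherwise the two ends of the edge would form a component.

  no-west-east-edge : ∀ {a} → IsEdgeOf west D a → ¬ IsEdgeOf east D a
  no-west-east-edge {a} (a∈ , w-vertex) (_ , e-vertex) with inner-exists
  ... | x , i with trail (end∈V west a∈) (Inner⇒∈V i)
  ... | _ , t with stays t (inj₁ refl)
    where
    stays : ∀ {u es v} → Trail D u es v → u ≡ W D a ⊎ u ≡ E D a → v ≡ W D a ⊎ v ≡ E D a
    stays [] h = h
    stays (via b∈ (inj₁ (Wb , Eb)) t) (inj₁ refl)
      with refl ← edge-unique west w-vertex (a∈ , refl) (b∈ , Wb) = stays t (inj₂ (sym Eb))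
    stays (via b∈ (inj₂ (Eb , Wb)) t) (inj₁ refl) = contradiction Eb (proj₂ w-vertex _ b∈)
    stays (via b∈ (inj₁ (Wb , Eb)) t) (inj₂ refl) = contradiction Wb (proj₂ e-vertex _ b∈)
    stays (via b∈ (inj₂ (Eb , Wb)) t) (inj₂ refl)
      with refl ← edge-unique east e-vertex (a∈ , refl) (b∈ , Eb) = stays t (inj₁ (sym Wb))
  ... | inj₁ refl = Inner⇒¬IsVertexOf west i w-vertex
  ... | inj₂ refl = Inner⇒¬IsVertexOf east i e-vertex

  west-end-vertex : ∀ {a} → a ∈ A D → ¬ Inner D (W D a) → IsVertexOf west D (W D a)
  west-end-vertex {a} a∈ ¬i with edge-at? east (W D a)
  ... | inj₁ (b , at) = contradiction (inner west (a∈ , refl) at) ¬i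
  ... | inj₂ none = end∈V west a∈ , none

  east-end-vertex : ∀ {a} → a ∈ A D → ¬ Inner D (E D a) → IsVertexOf east D (E D a)
  east-end-vertex {a} a∈ ¬i with edge-at? west (E D a)
  ... | inj₁ (b , at) = contradiction (inner east (a∈ , refl) at) ¬i
  ... | inj₂ none = end∈V east a∈ , none

  no-loop : ∀ {a} → a ∈ A D → W D a ≢ E D a
  no-loop {a} a∈ eq = acyclic a a∈ (subst (Walk D (E D a)) (sym eq) nil)

-- Drawings and the drawing of a basic D-graph

-- Constructions list boundary vertices while slices list edges; `map-σ` and `map-τ` tie the two
-- together. The last two fields say that each inner vertex is swept exactly once.
record Drawing (D : Graph) (LW LE : List ℕ) : Set where
  field
    σ τ xs   : List ℕ
    sweep    : Sweep D σ xs τ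
    map-σ    : map (W D) σ ≡ LW
    map-τ    : map (E D) τ ≡ LE
    σ⊆A      : ∀ a → a ∈ σ → a ∈ A D
    xs-unique : Unique xs
    xs-all   : ∀ x → Inner D x → x ∈ xs

  τ⊆A : ∀ a → a ∈ τ → a ∈ A D
  τ⊆A = Sweep-edges sweep σ⊆A

-- One step suffices. An edge cannot be both a W-edge and an E-edge and there are no loops, so the
-- edges entering the only inner vertex are the W-edges and those leaving it are the E-edges.
basic-drawing : ∀ {D LW LE} → IsBasicDGraph D → IsListOf west D LW → IsListOf east D LE →
  Drawing D LW LE
basic-drawing {D} {LW} {LE} (d , x , x-inner , x-only) lw le
  with edges-of-vertices d west LW (proj₁ (proj₂ lw)) | edges-of-vertices d east LE (proj₁ (proj₂ le))
... | σ , map-σ , σ⊆ | τ , map-τ , τ⊆ = record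
  { σ = σ ; τ = τ ; xs = x ∷ []
  ; sweep = step [] σ τ [] star (sym (++-identityʳ σ)) (sym (++-identityʳ τ)) ∷ []
  ; map-σ = map-σ ; map-τ = map-τ ; σ⊆A = σ⊆
  ; xs-unique = [] ∷ []
  ; xs-all = λ y i → here (only i) }
  where
  i : Inner D x
  i = IsInnerVertex⇒Inner d x-inner
  only : ∀ {y} → Inner D y → y ≡ x
  only i = x-only _ (Inner⇒IsInnerVertex d i)
  W-edge⇒ : ∀ a → IsEdgeOf west D a → At east D x a
  W-edge⇒ a w@(a∈ , _) with E D a ≟ x
  ... | yes eq = a∈ , eq
  ... | no ≢x = contradiction (a∈ , east-end-vertex d a∈ (λ i → ≢x (only i))) (no-west-east-edge d w)
  W-edge⇐ : ∀ a → At east D x a → IsEdgeOf west D a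
  W-edge⇐ a (a∈ , eq) = a∈ , west-end-vertex d a∈ λ i → no-loop d a∈ (trans (only i) (sym eq))
  E-edge⇒ : ∀ a → IsEdgeOf east D a → At west D x a
  E-edge⇒ a e@(a∈ , _) with W D a ≟ x
  ... | yes eq = a∈ , eq
  ... | no ≢x = contradiction e (no-west-east-edge d (a∈ , west-end-vertex d a∈ (λ i → ≢x (only i))))
  E-edge⇐ : ∀ a → At west D x a → IsEdgeOf east D a
  E-edge⇐ a (a∈ , eq) = a∈ , east-end-vertex d a∈ λ i → no-loop d a∈ (trans eq (sym (only i)))
  ins′ : σ Enumerates At east D x
  ins′ = Enumerates-resp W-edge⇒ W-edge⇐ (boundary-Enumerates d west lw map-σ σ⊆)
  outs′ : τ Enumerates At west D x
  outs′ = Enumerates-resp E-edge⇒ E-edge⇐ (boundary-Enumerates d east le map-τ τ⊆)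
  star : Star D x σ τ
  star = record { ins = ins′ ; outs = outs′
                ; ins≢ = ∈⇒≢[] (proj₂ (proj₂ ins′) _ (proj₂ (i east)))
                ; outs≢ = ∈⇒≢[] (proj₂ (proj₂ outs′) _ (proj₂ (i west))) }

-- Junctures

-- The four forms of compatibility brought into a single one: a common middle `Ξ`, with at most one
-- non-empty list on each side of it.
record Split {L₁ L₂ : List ℕ} (c : Compatible L₁ L₂) : Set where
  field
    ΦE ΦW Ξ ΨE ΨW : List ℕ
    L₁≡ : L₁ ≡ ΦE ++ Ξ ++ ΨE
    L₂≡ : L₂ ≡ ΦW ++ Ξ ++ ΨW
    newW≡ : ∀ L → newWList c L ≡ ΦW ++ L ++ ΨW
    newE≡ : ∀ L → newEList c L ≡ ΦE ++ L ++ ΨE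
    ΦE-private : Disjoint ΦE L₂
    ΨE-private : Disjoint ΨE L₂
    ΦW-private : Disjoint ΦW L₁
    ΨW-private : Disjoint ΨW L₁
    Φ-one : ΦE ≡ [] ⊎ ΦW ≡ []
    Ψ-one : ΨE ≡ [] ⊎ ΨW ≡ []

Disjoint-++ʳ : ∀ {l m n : List ℕ} → Disjoint l m → Disjoint l n → Disjoint l (m ++ n)
Disjoint-++ʳ {m = m} lm ln (v∈l , v∈) with ∈-++⁻ m v∈
... | inj₁ v∈m = lm (v∈l , v∈m)
... | inj₂ v∈n = ln (v∈l , v∈n)

[]-disjoint : ∀ {l : List ℕ} → Disjoint [] l
[]-disjoint (() , _)

split : ∀ {L₁ L₂} (c : Compatible L₁ L₂) → Split c
split (c₁ Φ Ξ Ψ (ΦΞ , ΞΨ , ΦΨ) _ refl refl) = record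
  { ΦE = Φ ; ΦW = [] ; Ξ = Ξ ; ΨE = [] ; ΨW = Ψ
  ; L₁≡ = cong (Φ ++_) (sym (++-identityʳ Ξ)) ; L₂≡ = refl
  ; newW≡ = λ L → refl ; newE≡ = λ L → cong (Φ ++_) (sym (++-identityʳ L))
  ; ΦE-private = Disjoint-++ʳ ΦΞ ΦΨ ; ΨE-private = []-disjoint ; ΦW-private = []-disjoint
  ; ΨW-private = Disjoint-++ʳ (Disjoint-sym ΦΨ) (Disjoint-sym ΞΨ)
  ; Φ-one = inj₂ refl ; Ψ-one = inj₁ refl }
split (c₂ Φ Ξ Ψ (ΦΞ , ΞΨ , ΦΨ) _ refl refl) = record
  { ΦE = [] ; ΦW = Φ ; Ξ = Ξ ; ΨE = Ψ ; ΨW = []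
  ; L₁≡ = refl ; L₂≡ = cong (Φ ++_) (sym (++-identityʳ Ξ))
  ; newW≡ = λ L → cong (Φ ++_) (sym (++-identityʳ L)) ; newE≡ = λ L → refl
  ; ΦE-private = []-disjoint ; ΨE-private = Disjoint-++ʳ (Disjoint-sym ΦΨ) (Disjoint-sym ΞΨ)
  ; ΦW-private = Disjoint-++ʳ ΦΞ ΦΨ ; ΨW-private = []-disjoint
  ; Φ-one = inj₁ refl ; Ψ-one = inj₂ refl }
split (c₃ Φ Ξ Ψ (ΦΞ , ΞΨ , ΦΨ) _ refl refl) = record
  { ΦE = Φ ; ΦW = [] ; Ξ = Ξ ; ΨE = Ψ ; ΨW = []
  ; L₁≡ = refl ; L₂≡ = sym (++-identityʳ Ξ)
  ; newW≡ = λ L → sym (++-identityʳ L) ; newE≡ = λ L → refl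
  ; ΦE-private = ΦΞ ; ΨE-private = Disjoint-sym ΞΨ
  ; ΦW-private = []-disjoint ; ΨW-private = []-disjoint
  ; Φ-one = inj₂ refl ; Ψ-one = inj₂ refl }
split (c₄ Φ Ξ Ψ (ΦΞ , ΞΨ , ΦΨ) _ refl refl) = record
  { ΦE = [] ; ΦW = Φ ; Ξ = Ξ ; ΨE = [] ; ΨW = Ψ
  ; L₁≡ = sym (++-identityʳ Ξ) ; L₂≡ = refl
  ; newW≡ = λ L → refl ; newE≡ = λ L → sym (++-identityʳ L)
  ; ΦE-private = []-disjoint ; ΨE-private = []-disjoint
  ; ΦW-private = ΦΞ ; ΨW-private = Disjoint-sym ΞΨ
  ; Φ-one = inj₁ refl ; Ψ-one = inj₁ refl }

map-++⁻ : ∀ (f : ℕ → ℕ) l Φ {Ψ} → map f l ≡ Φ ++ Ψ →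
  ∃ λ φ → ∃ λ ψ → l ≡ φ ++ ψ × map f φ ≡ Φ × map f ψ ≡ Ψ
map-++⁻ f l [] eq = [] , l , refl , refl , eq
map-++⁻ f (a ∷ l) (v ∷ Φ) eq with ∷-injective eq
... | refl , eq′ with map-++⁻ f l Φ eq′
... | φ , ψ , refl , refl , refl = a ∷ φ , ψ , refl , refl , refl

map≡[] : ∀ {f : ℕ → ℕ} {l} → map f l ≡ [] → l ≡ []
map≡[] {l = []} _ = refl

-- Compatibility gives emptiness for lists of vertices, but the lists to be commuted consist of
-- edges; hence the maps.
one-empty⇒comm : ∀ {f g : ℕ → ℕ} {φ ψ Φ Ψ} → map f φ ≡ Φ → map g ψ ≡ Ψ → Φ ≡ [] ⊎ Ψ ≡ [] →
  ψ ++ φ ≡ φ ++ ψ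
one-empty⇒comm {ψ = ψ} eq _ (inj₁ refl) rewrite map≡[] eq = ++-identityʳ ψ
one-empty⇒comm {φ = φ} _ eq (inj₂ refl) rewrite map≡[] eq = sym (++-identityʳ φ)

module Juncture {DW DE : Graph}
  (dW : IsDGraph DW) (dE : IsDGraph DE) (j : JunctureDefined DW DE) where

  D : Graph
  D = DW □ DE

  W-left : ∀ {a} → a ∈ A DW → W D a ≡ W DW a
  W-left {a} a∈ = cong (λ b → if b then W DW a else W DE a) (dec-true (a ∈? A DW) a∈)

  W-right : ∀ {a} → a ∉ A DW → W D a ≡ W DE a
  W-right {a} a∉ = cong (λ b → if b then W DW a else W DE a) (dec-false (a ∈? A DW) a∉)

  E-right : ∀ {a} → a ∈ A DE → E D a ≡ E DE a
  E-right {a} a∈ = cong (λ b → if b then E DE a else E DW a) (dec-true (a ∈? A DE) a∈)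

  E-left : ∀ {a} → a ∉ A DE → E D a ≡ E DW a
  E-left {a} a∉ = cong (λ b → if b then E DE a else E DW a) (dec-false (a ∈? A DE) a∉)

  A-left : ∀ {a} → a ∈ A DW → a ∈ A D
  A-left = ∈-++⁺ˡ

  A-right : ∀ {a} → a ∈ A DE → a ∈ A D
  A-right {a} a∈ with a ∈? A DW
  ... | yes a∈W = ∈-++⁺ˡ a∈W
  ... | no a∉W = ∈-++⁺ʳ (A DW) (∈-filter⁺ (λ a → ¬? (a ∈? A DW)) a∈ a∉W)

  A-cases : ∀ {a} → a ∈ A D → a ∈ A DW ⊎ (a ∈ A DE × a ∉ A DW)
  A-cases {a} a∈ with ∈-++⁻ (A DW) a∈
  ... | inj₁ a∈W = inj₁ a∈W
  ... | inj₂ a∈′ = inj₂ (∈-filter⁻ (λ a → ¬? (a ∈? A DW)) {xs = A DE} a∈′)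

  A-cases′ : ∀ {a} → a ∈ A D → a ∈ A DE ⊎ (a ∈ A DW × a ∉ A DE)
  A-cases′ {a} a∈ with a ∈? A DE | A-cases a∈
  ... | yes a∈E | _ = inj₁ a∈E
  ... | no a∉E | inj₁ a∈W = inj₂ (a∈W , a∉E)
  ... | no a∉E | inj₂ (a∈E , _) = contradiction a∈E a∉E

  common-edge : ∀ {v} → v ∈ V DW → v ∈ V DE →
    ∃ λ c → At east DW v c × At west DE v c × IsVertexOf east DW v × IsVertexOf west DE v
  common-edge v∈W v∈E with proj₁ (proj₂ (proj₂ j)) _ v∈W v∈E
  ... | c , c∈W , c∈E , refl with proj₁ (proj₂ j) c c∈W c∈E
  ... | eq , (_ , e-vertex) , (_ , w-vertex) =
    c , (c∈W , refl) , (c∈E , sym eq) , e-vertex , subst (IsVertexOf west DE) (sym eq) w-vertex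

  not-common-left : ∀ {x} → Inner DW x → x ∉ V DE
  not-common-left i x∈E with common-edge (Inner⇒∈V dW i) x∈E
  ... | _ , _ , _ , e-vertex , _ = Inner⇒¬IsVertexOf east i e-vertex

  not-common-right : ∀ {x} → Inner DE x → x ∉ V DW
  not-common-right i x∈W with common-edge x∈W (Inner⇒∈V dE i)
  ... | _ , _ , _ , _ , w-vertex = Inner⇒¬IsVertexOf west i w-vertex

  -- A juncture redirects edges only at the glued vertices, and these are E-vertices of `DW`, hence
  -- not inner there.
  same-left : ∀ {x} → Inner DW x → SameStar DW D x
  same-left {x} i west a = to , from
    where
    to : At west DW x a → At west D x a
    to (a∈ , eq) = A-left a∈ , trans (W-left a∈) eq
    from : At west D x a → At west DW x a
    from (a∈ , eq) with A-cases a∈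
    ... | inj₁ a∈W = a∈W , trans (sym (W-left a∈W)) eq
    ... | inj₂ (a∈E , a∉W) =
      contradiction (subst (_∈ V DE) (trans (sym (W-right a∉W)) eq) (end∈V dE west a∈E)) (not-common-left i)
  same-left {x} i east a = to , from
    where
    to : At east DW x a → At east D x a
    to (a∈ , eq) with toSum (a ∈? A DE)
    ... | inj₂ a∉E = A-left a∈ , trans (E-left a∉E) eq
    ... | inj₁ a∈E with proj₁ (proj₂ j) a a∈ a∈E
    ...   | _ , (_ , e-vertex) , _ =
      contradiction (subst (IsVertexOf east DW) eq e-vertex) (Inner⇒¬IsVertexOf east i)
    from : At east D x a → At east DW x a
    from (a∈ , eq) with A-cases′ a∈
    ... | inj₁ a∈E =
      contradiction (subst (_∈ V DE) (trans (sym (E-right a∈E)) eq) (end∈V dE east a∈E)) (not-common-left i)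
    ... | inj₂ (a∈W , a∉E) = a∈W , trans (sym (E-left a∉E)) eq

  same-right : ∀ {x} → Inner DE x → SameStar DE D x
  same-right {x} i east a = to , from
    where
    to : At east DE x a → At east D x a
    to (a∈ , eq) = A-right a∈ , trans (E-right a∈) eq
    from : At east D x a → At east DE x a
    from (a∈ , eq) with A-cases′ a∈
    ... | inj₁ a∈E = a∈E , trans (sym (E-right a∈E)) eq
    ... | inj₂ (a∈W , a∉E) =
      contradiction (subst (_∈ V DW) (trans (sym (E-left a∉E)) eq) (end∈V dW east a∈W)) (not-common-right i)
  same-right {x} i west a = to , from
    where
    to : At west DE x a → At west D x a
    to (a∈ , eq) with toSum (a ∈? A DW)
    ... | inj₂ a∉W = A-right a∈ , trans (W-right a∉W) eq
    ... | inj₁ a∈W with proj₁ (proj₂ j) a a∈W a∈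
    ...   | _ , _ , (_ , w-vertex) =
      contradiction (subst (IsVertexOf west DE) eq w-vertex) (Inner⇒¬IsVertexOf west i)
    from : At west D x a → At west DE x a
    from (a∈ , eq) with A-cases a∈
    ... | inj₁ a∈W =
      contradiction (subst (_∈ V DW) (trans (sym (W-left a∈W)) eq) (end∈V dW west a∈W)) (not-common-right i)
    ... | inj₂ (a∈E , a∉W) = a∈E , trans (sym (W-right a∉W)) eq

  -- If the edges leaving and entering `x` came from different graphs, `x` would be a glued vertex.
  -- Either it is then an E-vertex of `DW` that an edge of `DW` leaves, or functionality makes the
  -- entering edge the common one, which lies in `DE` after all.
  inner-cases : ∀ {x} → Inner D x → Inner DW x ⊎ Inner DE x
  inner-cases i with i west | i east
  ... | b , b∈ , Wb | a , a∈ , Ea with A-cases b∈ | A-cases′ a∈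
  ... | inj₁ b∈W | inj₂ (a∈W , a∉E) =
    inj₁ (inner west (b∈W , trans (sym (W-left b∈W)) Wb) (a∈W , trans (sym (E-left a∉E)) Ea))
  ... | inj₂ (b∈E , b∉W) | inj₁ a∈E =
    inj₂ (inner west (b∈E , trans (sym (W-right b∉W)) Wb) (a∈E , trans (sym (E-right a∈E)) Ea))
  ... | inj₁ b∈W | inj₁ a∈E
    with common-edge (subst (_∈ V DW) (trans (sym (W-left b∈W)) Wb) (end∈V dW west b∈W))
                     (subst (_∈ V DE) (trans (sym (E-right a∈E)) Ea) (end∈V dE east a∈E))
  ...   | _ , _ , _ , e-vertex , _ =
    contradiction (trans (sym (W-left b∈W)) Wb) (proj₂ e-vertex b b∈W)
  inner-cases i | b , b∈ , Wb | a , a∈ , Ea | inj₂ (b∈E , b∉W) | inj₂ (a∈W , a∉E)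
    with common-edge (subst (_∈ V DW) (trans (sym (E-left a∉E)) Ea) (end∈V dW east a∈W))
                     (subst (_∈ V DE) (trans (sym (W-right b∉W)) Wb) (end∈V dE west b∈E))
  ...   | c , at-c , (c∈E , _) , e-vertex , _ =
    contradiction
      (subst (_∈ A DE) (edge-unique dW east e-vertex (a∈W , trans (sym (E-left a∉E)) Ea) at-c) c∈E) a∉E

  -- Edges with the same end meet at a glued vertex, where functionality in either graph identifies
  -- them with the common edge.
  common-edges-≡ : ∀ ξ ξ′ → map (E DW) ξ ≡ map (W DE) ξ′ →
    (∀ a → a ∈ ξ → a ∈ A DW) → (∀ a → a ∈ ξ′ → a ∈ A DE) → ξ ≡ ξ′
  common-edges-≡ [] [] eq h h′ = refl
  common-edges-≡ (a ∷ ξ) (b ∷ ξ′) eq h h′ with ∷-injective eq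
  ... | eq₁ , eq₂ = cong₂ _∷_ a≡b (common-edges-≡ ξ ξ′ eq₂
    (λ c c∈ → h c (there c∈)) (λ c c∈ → h′ c (there c∈)))
    where
    a∈ : a ∈ A DW
    a∈ = h a (here refl)
    b∈ : b ∈ A DE
    b∈ = h′ b (here refl)
    a≡b : a ≡ b
    a≡b with common-edge (end∈V dW east a∈) (subst (_∈ V DE) (sym eq₁) (end∈V dE west b∈))
    ... | c , at-c , at-c′ , e-vertex , w-vertex =
      trans (edge-unique dW east e-vertex at-c (a∈ , refl))
            (sym (edge-unique dE west w-vertex at-c′ (b∈ , sym eq₁)))

  -- A common edge in `φ` would have its west end on the list of E-vertices of `DW`. So the edges of
  -- `φ` are not common, and the juncture keeps their west ends.
  private-W : ∀ {φ L} → IsListOf east DW L → (∀ a → a ∈ φ → a ∈ A DE) → Disjoint (map (W DE) φ) L →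
    map (W D) φ ≡ map (W DE) φ
  private-W {φ} (_ , _ , complete) φ⊆ dis = map-cong-local (All.tabulate λ {a} a∈φ → W-right λ a∈W →
    let eq , (_ , e-vertex) , _ = proj₁ (proj₂ j) a a∈W (φ⊆ a a∈φ) in
    dis (∈-map⁺ (W DE) a∈φ , complete _ (subst (IsVertexOf east DW) eq e-vertex)))

  private-E : ∀ {φ L} → IsListOf west DE L → (∀ a → a ∈ φ → a ∈ A DW) → Disjoint (map (E DW) φ) L →
    map (E D) φ ≡ map (E DW) φ
  private-E {φ} (_ , _ , complete) φ⊆ dis = map-cong-local (All.tabulate λ {a} a∈φ → E-left λ a∈E →
    let eq , _ , (_ , w-vertex) = proj₁ (proj₂ j) a (φ⊆ a a∈φ) a∈E in
    dis (∈-map⁺ (E DW) a∈φ , complete _ (subst (IsVertexOf west DE) (sym eq) w-vertex)))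

  -- First `DW` is swept with `φW` and `ψW` idle, then `DE` with `φE` and `ψE` idle. The two sweeps
  -- fit together because on each side of the common part one of the idle lists is empty.
  drawing : ∀ {LWW LWE LEW LEE} → IsListOf east DW LWE → IsListOf west DE LEW →
    (c : Compatible LWE LEW) → Drawing DW LWW LWE → Drawing DE LEW LEE →
    Drawing D (newWList c LWW) (newEList c LEE)
  drawing {LWW} {LWE} {LEW} {LEE} lWE lEW c dr₁ dr₂ with split c
  ... | record { ΦE = ΦE ; ΦW = ΦW ; Ξ = Ξ ; ΨE = ΨE ; ΨW = ΨW ; L₁≡ = L₁≡ ; L₂≡ = L₂≡
               ; newW≡ = newW≡ ; newE≡ = newE≡ ; ΦE-private = ΦE-p ; ΨE-private = ΨE-p
               ; ΦW-private = ΦW-p ; ΨW-private = ΨW-p ; Φ-one = Φ-one ; Ψ-one = Ψ-one }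
    with dr₁ | dr₂
  ... | dr₁@record { σ = σ₁ ; τ = τ₁ ; xs = xs₁ } | dr₂@record { σ = σ₂ ; τ = τ₂ ; xs = xs₂ }
    with map-++⁻ (E DW) τ₁ ΦE (trans (Drawing.map-τ dr₁) L₁≡)
       | map-++⁻ (W DE) σ₂ ΦW (trans (Drawing.map-σ dr₂) L₂≡)
  ... | φE , ρE , eqτ , refl , eqρE | φW , ρW , eqσ , refl , eqρW
    with map-++⁻ (E DW) ρE Ξ eqρE | map-++⁻ (W DE) ρW Ξ eqρW
  ... | ξ , ψE , refl , eqξ , refl | ξ′ , ψW , refl , eqξ′ , refl = record
    { σ = φW ++ σ₁ ++ ψW ; τ = φE ++ τ₂ ++ ψE ; xs = xs₁ ++ xs₂
    ; sweep = subst (λ τ → Sweep D (φW ++ σ₁ ++ ψW) xs₁ (φW ++ τ ++ ψW)) eqτ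
                (Sweep-frame φW ψW (Sweep-transfer (λ x x∈ → same-left (inner₁ x x∈)) (Drawing.sweep dr₁)))
              ⊕ subst (λ ρ → Sweep D ρ xs₂ (φE ++ τ₂ ++ ψE)) middle
                (Sweep-frame φE ψE (Sweep-transfer (λ x x∈ → same-right (inner₂ x x∈)) (Drawing.sweep dr₂)))
    ; map-σ = trans (map-++₃ (W D) φW σ₁ ψW)
              (trans (cong₂ _++_ (private-W lWE φW⊆ ΦW-p)
                       (cong₂ _++_ (trans (map-cong-local (All.tabulate λ {a} a∈ → W-left (Drawing.σ⊆A dr₁ a a∈)))
                                          (Drawing.map-σ dr₁))
                                   (private-W lWE ψW⊆ ΨW-p)))
                     (sym (newW≡ LWW)))
    ; map-τ = trans (map-++₃ (E D) φE τ₂ ψE)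
              (trans (cong₂ _++_ (private-E lEW φE⊆ ΦE-p)
                       (cong₂ _++_ (trans (map-cong-local (All.tabulate λ {a} a∈ → E-right (Drawing.τ⊆A dr₂ a a∈)))
                                          (Drawing.map-τ dr₂))
                                   (private-E lEW ψE⊆ ΨE-p)))
                     (sym (newE≡ LEE)))
    ; σ⊆A = λ a a∈ → [ (λ a∈φ → A-right (φW⊆ a a∈φ)) ,
                       (λ a∈′ → [ (λ a∈σ → A-left (Drawing.σ⊆A dr₁ a a∈σ)) ,
                                  (λ a∈ψ → A-right (ψW⊆ a a∈ψ)) ]′ (∈-++⁻ σ₁ a∈′)) ]′ (∈-++⁻ φW a∈)
    ; xs-unique = Unique-++⁺ (Drawing.xs-unique dr₁) (Drawing.xs-unique dr₂)
                    λ { (x∈₁ , x∈₂) → not-common-left (inner₁ _ x∈₁) (Inner⇒∈V dE (inner₂ _ x∈₂)) }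
    ; xs-all = λ x i → [ (λ i₁ → ∈-++⁺ˡ (Drawing.xs-all dr₁ x i₁)) ,
                         (λ i₂ → ∈-++⁺ʳ xs₁ (Drawing.xs-all dr₂ x i₂)) ]′ (inner-cases i) }
    where
    inner₁ : ∀ x → x ∈ xs₁ → Inner DW x
    inner₁ = Sweep⇒Inner (Drawing.sweep dr₁)
    inner₂ : ∀ x → x ∈ xs₂ → Inner DE x
    inner₂ = Sweep⇒Inner (Drawing.sweep dr₂)
    τ₁⊆ : ∀ a → a ∈ φE ++ ξ ++ ψE → a ∈ A DW
    τ₁⊆ a a∈ = Drawing.τ⊆A dr₁ a (subst (a ∈_) (sym eqτ) a∈)
    σ₂⊆ : ∀ a → a ∈ φW ++ ξ′ ++ ψW → a ∈ A DE
    σ₂⊆ a a∈ = Drawing.σ⊆A dr₂ a (subst (a ∈_) (sym eqσ) a∈)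
    φE⊆ : ∀ a → a ∈ φE → a ∈ A DW
    φE⊆ a a∈ = τ₁⊆ a (∈-++⁺ˡ a∈)
    ψE⊆ : ∀ a → a ∈ ψE → a ∈ A DW
    ψE⊆ a a∈ = τ₁⊆ a (∈-++⁺ʳ φE (∈-++⁺ʳ ξ a∈))
    φW⊆ : ∀ a → a ∈ φW → a ∈ A DE
    φW⊆ a a∈ = σ₂⊆ a (∈-++⁺ˡ a∈)
    ψW⊆ : ∀ a → a ∈ ψW → a ∈ A DE
    ψW⊆ a a∈ = σ₂⊆ a (∈-++⁺ʳ φW (∈-++⁺ʳ ξ′ a∈))
    ξ≡ξ′ : ξ ≡ ξ′
    ξ≡ξ′ = common-edges-≡ ξ ξ′ (trans eqξ (sym eqξ′)) (λ a a∈ → τ₁⊆ a (∈-++⁺ʳ φE (∈-++⁺ˡ a∈)))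
             (λ a a∈ → σ₂⊆ a (∈-++⁺ʳ φW (∈-++⁺ˡ a∈)))
    middle : φE ++ σ₂ ++ ψE ≡ φW ++ (φE ++ ξ ++ ψE) ++ ψW
    middle = begin
      φE ++ σ₂ ++ ψE                   ≡⟨ cong (λ z → φE ++ z ++ ψE) eqσ ⟩
      φE ++ (φW ++ ξ′ ++ ψW) ++ ψE     ≡⟨ reframe φE φW ξ′ ψW ψE ⟩
      (φE ++ φW) ++ ξ′ ++ (ψW ++ ψE)   ≡⟨ cong₂ (λ y z → y ++ ξ′ ++ z)
                                           (sym (one-empty⇒comm {E DW} {W DE} refl refl Φ-one))
                                           (one-empty⇒comm {E DW} {W DE} refl refl Ψ-one) ⟩
      (φW ++ φE) ++ ξ′ ++ (ψE ++ ψW)   ≡⟨ cong (λ z → (φW ++ φE) ++ z ++ (ψE ++ ψW)) (sym ξ≡ξ′) ⟩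
      (φW ++ φE) ++ ξ ++ (ψE ++ ψW)    ≡⟨ sym (reframe φW φE ξ ψE ψW) ⟩
      φW ++ (φE ++ ξ ++ ψE) ++ ψW      ∎ where open ≡-Reasoning
    map-++₃ : ∀ f (k l m : List ℕ) → map f (k ++ l ++ m) ≡ map f k ++ map f l ++ map f m
    map-++₃ f k l m = trans (map-++ f k (l ++ m)) (cong (map f k ++_) (map-++ f l m))

construction-data : ∀ {D LW LE} → Construction D LW LE →
  IsDGraph D × IsListOf west D LW × IsListOf east D LE
construction-data (leaf (d , _) lw le) = d , lw , le
construction-data (node _ _ _ _ d lw le) = d , lw , le

construction-drawing : ∀ {D LW LE} → Construction D LW LE → Drawing D LW LE
construction-drawing (leaf b lw le) = basic-drawing b lw le
construction-drawing (node kW kE j c d lw le) with construction-data kW | construction-data kE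
... | dW , _ , lWE | dE , lEW , _ =
  Juncture.drawing dW dE j lWE lEW c (construction-drawing kW) (construction-drawing kE)

-- Cutting along a cocycle

Unique-++⇒disjoint : ∀ l {m : List ℕ} → Unique (l ++ m) → Disjoint l m
Unique-++⇒disjoint (a ∷ l) u (here refl , v∈m) = Unique[x∷xs]⇒x∉xs u (∈-++⁺ʳ l v∈m)
Unique-++⇒disjoint (a ∷ l) (_ ∷ u) (there v∈l , v∈m) = Unique-++⇒disjoint l u (v∈l , v∈m)

-- Compatibility of two convex parts of a slice

module Halves (M N : List ℕ) where

  Only : List ℕ → List ℕ → ℕ → Set
  Only K K′ a = a ∈ K × a ∉ K′

  Convex : List ℕ → List ℕ → Set
  Convex K l = ∀ {i j k} → (i ∷ j ∷ k ∷ []) ⊑ l → i ∈ K → k ∈ K → j ∈ K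

  OneSided : List ℕ → Set
  OneSided l = All (Only M N) l ⊎ All (Only N M) l

  Both : ℕ → Set
  Both a = a ∈ M × a ∈ N

  Cover : List ℕ → Set
  Cover l = ∀ a → a ∈ l → a ∈ M ⊎ a ∈ N

  convex-tail : ∀ {K a l} → Convex K (a ∷ l) → Convex K l
  convex-tail {a = a} cv s = cv (a ∷ʳ s)

  cover-tail : ∀ {a l} → Cover (a ∷ l) → Cover l
  cover-tail cov b b∈ = cov b (there b∈)

  classify : ∀ {a l} → Cover l → a ∈ l → Both a ⊎ (Only M N a ⊎ Only N M a)
  classify {a} cov a∈ with toSum (a ∈? M) | toSum (a ∈? N) | cov a a∈
  ... | inj₁ m | inj₁ n | _ = inj₁ (m , n)
  ... | inj₁ m | inj₂ n | _ = inj₂ (inj₁ (m , n))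
  ... | inj₂ m | inj₁ n | _ = inj₂ (inj₂ (n , m))
  ... | inj₂ m | inj₂ n | inj₁ m′ = contradiction m′ m
  ... | inj₂ m | inj₂ n | inj₂ n′ = contradiction n′ n

  ⊑-pair : ∀ {a b} {l : List ℕ} → b ∈ l → (a ∷ b ∷ []) ⊑ (a ∷ l)
  ⊑-pair b∈ = refl ∷ from∈ b∈

  -- Let `b` be the first edge after `c` that is missing from one of `M` and `N`. By convexity
  -- nothing after `b` lies in that set, for otherwise `b` would lie between it and `c`.
  suffix : ∀ c l → Both c → Cover l → Convex M (c ∷ l) → Convex N (c ∷ l) →
    ∃ λ ξ → ∃ λ β → l ≡ ξ ++ β × All Both ξ × OneSided β
  suffix c [] _ _ _ _ = [] , [] , refl , [] , inj₁ []
  suffix c (b ∷ l) both-c@(cM , cN) cov cvM cvN with classify cov (here refl)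
  ... | inj₁ both-b with suffix b l both-b (cover-tail cov) (convex-tail cvM) (convex-tail cvN)
  ...   | ξ , β , refl , both , one = b ∷ ξ , β , refl , both-b ∷ both , one
  suffix c (b ∷ l) both-c@(cM , cN) cov cvM cvN | inj₂ (inj₁ b-only@(bM , b∉N)) =
    [] , b ∷ l , refl , [] , inj₁ (b-only ∷ All.tabulate only)
    where
    only : ∀ {a} → a ∈ l → Only M N a
    only a∈ with classify cov (there a∈)
    ... | inj₁ (_ , aN) = contradiction (cvN (refl ∷ ⊑-pair a∈) cN aN) b∉N
    ... | inj₂ (inj₁ a-only) = a-only
    ... | inj₂ (inj₂ (aN , _)) = contradiction (cvN (refl ∷ ⊑-pair a∈) cN aN) b∉N
  suffix c (b ∷ l) both-c@(cM , cN) cov cvM cvN | inj₂ (inj₂ b-only@(bN , b∉M)) =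
    [] , b ∷ l , refl , [] , inj₂ (b-only ∷ All.tabulate only)
    where
    only : ∀ {a} → a ∈ l → Only N M a
    only a∈ with classify cov (there a∈)
    ... | inj₁ (aM , _) = contradiction (cvM (refl ∷ ⊑-pair a∈) cM aM) b∉M
    ... | inj₂ (inj₁ (aM , _)) = contradiction (cvM (refl ∷ ⊑-pair a∈) cM aM) b∉M
    ... | inj₂ (inj₂ a-only) = a-only

  -- Ahead of the first common edge `c′` only edges of one kind can occur: if two neighbours were of
  -- different kinds, convexity applied to the earlier one and `c′` would put the later one into
  -- both sets.
  factorise : ∀ l → Cover l → Convex M l → Convex N l → (∃ λ c → c ∈ l × Both c) →
    ∃ λ α → ∃ λ ξ → ∃ λ β → l ≡ α ++ ξ ++ β × ξ ≢ [] × All Both ξ × OneSided α × OneSided β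
  factorise (a ∷ l) cov cvM cvN c with classify cov (here refl)
  ... | inj₁ both-a with suffix a l both-a (cover-tail cov) cvM cvN
  ...   | ξ , β , refl , both , one =
    [] , a ∷ ξ , β , refl , (λ ()) , both-a ∷ both , inj₁ [] , one
  factorise (a ∷ l) cov cvM cvN (c , here refl , cM , cN) | inj₂ (inj₁ (_ , c∉N)) = contradiction cN c∉N
  factorise (a ∷ l) cov cvM cvN (c , here refl , cM , cN) | inj₂ (inj₂ (_ , c∉M)) = contradiction cM c∉M
  factorise (a ∷ l) cov cvM cvN (c , there c∈ , both-c) | inj₂ a-only
    with factorise l (cover-tail cov) (convex-tail cvM) (convex-tail cvN) (c , c∈ , both-c)
  ... | α , [] , β , _ , ξ≢[] , _ = contradiction refl ξ≢[]
  ... | α , c′ ∷ ξ , β , refl , ξ≢[] , both@((c′M , c′N) ∷ _) , α-one , β-one =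
    a ∷ α , c′ ∷ ξ , β , refl , ξ≢[] , both , extend a-only α-one , β-one
    where
    sub : ∀ {z α} → (a ∷ z ∷ c′ ∷ []) ⊑ (a ∷ (z ∷ α) ++ c′ ∷ ξ ++ β)
    sub {α = α} = refl ∷ ⊑-pair (∈-++⁺ʳ α (here refl))
    extend : Only M N a ⊎ Only N M a → OneSided α → OneSided (a ∷ α)
    extend (inj₁ a-only) (inj₁ all) = inj₁ (a-only ∷ all)
    extend (inj₂ a-only) (inj₂ all) = inj₂ (a-only ∷ all)
    extend (inj₁ a-only) (inj₂ []) = inj₁ (a-only ∷ [])
    extend (inj₂ a-only) (inj₁ []) = inj₂ (a-only ∷ [])
    extend (inj₁ (aM , _)) (inj₂ ((_ , z∉M) ∷ _)) = contradiction (cvM sub aM c′M) z∉M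
    extend (inj₂ (aN , _)) (inj₁ ((_ , z∉N) ∷ _)) = contradiction (cvN sub aN c′N) z∉N

  filter-++₃ : ∀ K (α ξ β : List ℕ) →
    filter (_∈? K) (α ++ ξ ++ β) ≡ filter (_∈? K) α ++ filter (_∈? K) ξ ++ filter (_∈? K) β
  filter-++₃ K α ξ β = trans (filter-++ (_∈? K) α (ξ ++ β))
    (cong (filter (_∈? K) α ++_) (filter-++ (_∈? K) ξ β))

  image-disjoint : ∀ {f g : ℕ → ℕ} {α β} → (∀ {a b} → a ∈ α → b ∈ β → f a ≢ g b) →
    Disjoint (map f α) (map g β)
  image-disjoint {f} {g} apart (v∈₁ , v∈₂) with ∈-map⁻ f v∈₁ | ∈-map⁻ g v∈₂
  ... | a , a∈ , eq | b , b∈ , eq′ = apart a∈ b∈ (trans (sym eq) eq′)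

  module _ (f g : ℕ → ℕ) (l : List ℕ) (l-unique : Unique l)
    (f-inj : ∀ {a b : ℕ} → a ∈ l → b ∈ l → a ∈ M → b ∈ M → f a ≡ f b → a ≡ b)
    (g-inj : ∀ {a b : ℕ} → a ∈ l → b ∈ l → a ∈ N → b ∈ N → g a ≡ g b → a ≡ b)
    (agree : ∀ {a : ℕ} → Both a → f a ≡ g a)
    (apart : ∀ {a b : ℕ} → a ∈ l → b ∈ l → Only M N a → Only N M b → f a ≢ g b) where

    -- The outer factors `α` and `β` belong to one set each, and the four combinations are exactly
    -- the four forms of compatibility.
    compatible : Cover l → Convex M l → Convex N l → (∃ λ c → c ∈ l × Both c) →
      Compatible (map f (filter (_∈? M) l)) (map g (filter (_∈? N) l))
    compatible cov cvM cvN c with factorise l cov cvM cvN c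
    ... | α , ξ , β , refl , ξ≢[] , both , α-one , β-one = build α-one β-one
      where
      inα : ∀ {a} → a ∈ α → a ∈ l
      inα = ∈-++⁺ˡ
      inξ : ∀ {a} → a ∈ ξ → a ∈ l
      inξ a∈ = ∈-++⁺ʳ α (∈-++⁺ˡ a∈)
      inβ : ∀ {a} → a ∈ β → a ∈ l
      inβ a∈ = ∈-++⁺ʳ α (∈-++⁺ʳ ξ a∈)
      αβ : ∀ {a} → a ∈ α → a ∉ β
      αβ a∈α a∈β = Unique-++⇒disjoint α l-unique (a∈α , ∈-++⁺ʳ ξ a∈β)
      Ξ : List ℕ
      Ξ = map f ξ
      Ξ≢[] : Ξ ≢ []
      Ξ≢[] eq = ξ≢[] (map≡[] eq)
      Ξ-g : map g ξ ≡ Ξ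
      Ξ-g = map-cong-local (All.tabulate λ {a} a∈ → sym (agree (All.lookup both a∈)))
      keepM : ∀ {a b} → filter (_∈? M) α ≡ a → filter (_∈? M) β ≡ b →
        map f (filter (_∈? M) (α ++ ξ ++ β)) ≡ map f a ++ Ξ ++ map f b
      keepM {a} {b} eqα eqβ = trans (cong (map f) (trans (filter-++₃ M α ξ β)
          (cong₂ _++_ eqα (cong₂ _++_ (filter-all (_∈? M) (All.map proj₁ both)) eqβ))))
        (trans (map-++ f a (ξ ++ b)) (cong (map f a ++_) (map-++ f ξ b)))
      keepG : ∀ {a b} → filter (_∈? N) α ≡ a → filter (_∈? N) β ≡ b →
        map g (filter (_∈? N) (α ++ ξ ++ β)) ≡ map g a ++ Ξ ++ map g b
      keepG {a} {b} eqα eqβ = trans (cong (map g) (trans (filter-++₃ N α ξ β)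
          (cong₂ _++_ eqα (cong₂ _++_ (filter-all (_∈? N) (All.map proj₂ both)) eqβ))))
        (trans (map-++ g a (ξ ++ b)) (cong (map g a ++_) (trans (map-++ g ξ b) (cong (_++ map g b) Ξ-g))))
      all : ∀ {K K′ γ} → All (Only K K′) γ → filter (_∈? K) γ ≡ γ
      all {K} h = filter-all (_∈? K) (All.map proj₁ h)
      none : ∀ {K K′ γ} → All (Only K K′) γ → filter (_∈? K′) γ ≡ []
      none {K′ = K′} h = filter-none (_∈? K′) (All.map proj₂ h)
      trim : ∀ {L Φ} → L ≡ Φ ++ Ξ ++ [] → L ≡ Φ ++ Ξ
      trim {Φ = Φ} eq = trans eq (cong (Φ ++_) (++-identityʳ Ξ))
      fξ : ∀ {γ} → (∀ {a} → a ∈ γ → a ∈ l) → All (Only M N) γ → Disjoint (map f γ) Ξ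
      fξ inγ h = image-disjoint λ a∈ b∈ eq → proj₂ (All.lookup h a∈)
        (subst (_∈ N) (sym (f-inj (inγ a∈) (inξ b∈)
                              (proj₁ (All.lookup h a∈)) (proj₁ (All.lookup both b∈)) eq))
               (proj₂ (All.lookup both b∈)))
      gξ : ∀ {γ} → (∀ {a} → a ∈ γ → a ∈ l) → All (Only N M) γ → Disjoint (map g γ) Ξ
      gξ {γ} inγ h = subst (Disjoint (map g γ)) Ξ-g (image-disjoint λ a∈ b∈ eq → proj₂ (All.lookup h a∈)
        (subst (_∈ M) (sym (g-inj (inγ a∈) (inξ b∈)
                              (proj₁ (All.lookup h a∈)) (proj₂ (All.lookup both b∈)) eq))
               (proj₁ (All.lookup both b∈))))
      build : OneSided α → OneSided β →
        Compatible (map f (filter (_∈? M) (α ++ ξ ++ β))) (map g (filter (_∈? N) (α ++ ξ ++ β)))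
      build (inj₁ hα) (inj₁ hβ) = c₃ (map f α) Ξ (map f β)
        (fξ inα hα , Disjoint-sym (fξ inβ hβ) , image-disjoint λ a∈ b∈ eq →
          αβ a∈ (subst (_∈ β) (sym (f-inj (inα a∈) (inβ b∈)
            (proj₁ (All.lookup hα a∈)) (proj₁ (All.lookup hβ b∈)) eq)) b∈))
        Ξ≢[] (keepM (all hα) (all hβ)) (trim (keepG (none hα) (none hβ)))
      build (inj₁ hα) (inj₂ hβ) = c₁ (map f α) Ξ (map g β)
        (fξ inα hα , Disjoint-sym (gξ inβ hβ) , image-disjoint λ a∈ b∈ →
          apart (inα a∈) (inβ b∈) (All.lookup hα a∈) (All.lookup hβ b∈))
        Ξ≢[] (trim (keepM (all hα) (none hβ))) (keepG (none hα) (all hβ))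
      build (inj₂ hα) (inj₁ hβ) = c₂ (map g α) Ξ (map f β)
        (gξ inα hα , Disjoint-sym (fξ inβ hβ) , image-disjoint λ a∈ b∈ eq →
          apart (inβ b∈) (inα a∈) (All.lookup hβ b∈) (All.lookup hα a∈) (sym eq))
        Ξ≢[] (keepM (none hα) (all hβ)) (trim (keepG (all hα) (none hβ)))
      build (inj₂ hα) (inj₂ hβ) = c₄ (map g α) Ξ (map g β)
        (gξ inα hα , Disjoint-sym (gξ inβ hβ) , image-disjoint λ a∈ b∈ eq →
          αβ a∈ (subst (_∈ β) (sym (g-inj (inα a∈) (inβ b∈)
            (proj₁ (All.lookup hα a∈)) (proj₁ (All.lookup hβ b∈)) eq)) b∈))
        Ξ≢[] (trim (keepM (none hα) (none hβ))) (keepG (all hα) (all hβ))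

-- The slice belonging to a set closed under predecessors

-- Here `μ` is the slice after sweeping just the inner vertices in `U`. The last three fields
-- characterise it: its edges are those with east end not yet swept and west end not still to be
-- swept.
record MiddleSlice (D : Graph) (U σ τ : List ℕ) : Set where
  field
    μ xs₁ xs₂ : List ℕ
    lower     : Sweep D σ xs₁ μ
    upper     : Sweep D μ xs₂ τ
    xs₁⊆U     : ∀ x → x ∈ xs₁ → x ∈ U
    xs₂∩U     : ∀ x → x ∈ xs₂ → x ∉ U
    xs-all    : ∀ x → Inner D x → x ∈ xs₁ ⊎ x ∈ xs₂
    μ-unique  : Unique μ
    μ⊆A       : ∀ a → a ∈ μ → a ∈ A D
    μ-lower   : ∀ a → a ∈ μ → E D a ∉ xs₁
    μ-upper   : ∀ a → a ∈ μ → W D a ∉ xs₂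
    μ-all     : ∀ a → a ∈ A D → E D a ∉ xs₁ → W D a ∉ xs₂ → a ∈ μ

-- Every property of `μ` is read off from the conservation law for the lower sweep, whose right side
-- is 0 or 1 for each edge.
middle-slice : ∀ {D LW LE} → IsDGraph D → IsListOf west D LW → (dr : Drawing D LW LE) →
  ∀ U → (∀ a → a ∈ A D → E D a ∈ U → W D a ∈ U) →
  MiddleSlice D U (Drawing.σ dr) (Drawing.τ dr)
middle-slice {D} d lw dr U closed with Sweep-sort U closed (Drawing.sweep dr)
... | μ , lower , upper = record
  { μ = μ ; xs₁ = xs₁ ; xs₂ = xs₂ ; lower = lower ; upper = upper
  ; xs₁⊆U = λ x x∈ → proj₂ (xs₁⁻ x∈)
  ; xs₂∩U = λ x x∈ → proj₂ (xs₂⁻ x∈)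
  ; xs-all = λ x i → xs-cases (Drawing.xs-all dr x i)
  ; μ-unique = mult≤1⇒Unique μ λ a a∈ → mult≤1 a (μ⊆A a a∈)
  ; μ⊆A = μ⊆A
  ; μ-lower = λ a a∈ Ea → mult≡0⇒∉ (mult-E a (μ⊆A a a∈) Ea) a∈
  ; μ-upper = λ a a∈ Wa → mult≡0⇒∉ (mult-W a (μ⊆A a a∈) Wa) a∈
  ; μ-all = λ a a∈ Ea Wa → in-μ a a∈ Ea Wa }
  where
  open Drawing dr using (σ; xs)
  xs₁ xs₂ : List ℕ
  xs₁ = filter (_∈? U) xs
  xs₂ = filter (λ x → ¬? (x ∈? U)) xs
  xs₁⁻ : ∀ {x} → x ∈ xs₁ → x ∈ xs × x ∈ U
  xs₁⁻ = ∈-filter⁻ (_∈? U) {xs = xs}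
  xs₂⁻ : ∀ {x} → x ∈ xs₂ → x ∈ xs × x ∉ U
  xs₂⁻ = ∈-filter⁻ (λ x → ¬? (x ∈? U)) {xs = xs}
  xs-cases : ∀ {x} → x ∈ xs → x ∈ xs₁ ⊎ x ∈ xs₂
  xs-cases {x} x∈ with toSum (x ∈? U)
  ... | inj₁ x∈U = inj₁ (∈-filter⁺ (_∈? U) x∈ x∈U)
  ... | inj₂ x∉U = inj₂ (∈-filter⁺ (λ x → ¬? (x ∈? U)) x∈ x∉U)
  σ-enum : σ Enumerates IsEdgeOf west D
  σ-enum = boundary-Enumerates d west lw (Drawing.map-σ dr) (Drawing.σ⊆A dr)
  μ⊆A : ∀ a → a ∈ μ → a ∈ A D
  μ⊆A = Sweep-edges lower (Drawing.σ⊆A dr)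
  count : ∀ a → a ∈ A D → mult a μ + mult (E D a) xs₁ ≡ mult a σ + mult (W D a) xs₁
  count = Sweep-mult lower
  xs₁-unique : Unique xs₁
  xs₁-unique = Unique-filter⁺ (_∈? U) (Drawing.xs-unique dr)
  inner-xs : ∀ {x} → x ∈ xs → Inner D x
  inner-xs = Sweep⇒Inner (Drawing.sweep dr) _
  σ-zero : ∀ a → W D a ∈ xs → mult a σ ≡ 0
  σ-zero a Wa = mult-∉ {a} {σ} λ a∈σ →
    Inner⇒¬IsVertexOf west (inner-xs Wa) (proj₂ (proj₁ (proj₂ σ-enum) a a∈σ))
  -- This counts how often `a` enters the lower slices: once from `σ` if its west end is not inner,
  -- once by a step if that end is in `xs₁`, and not at all if that end is swept later.
  source : ∀ a → a ∈ A D →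
    (W D a ∈ xs₂ × mult a σ + mult (W D a) xs₁ ≡ 0) ⊎ (mult a σ + mult (W D a) xs₁ ≡ 1)
  source a a∈ with toSum (W D a ∈? xs)
  ... | inj₂ Wa∉ = inj₂ (cong₂ _+_
          (mult-∈ {a} {σ} (proj₁ σ-enum)
            (proj₂ (proj₂ σ-enum) a (a∈ , west-end-vertex d a∈ (λ i → Wa∉ (Drawing.xs-all dr _ i)))))
          (mult-∉ {W D a} {xs₁} λ Wa → Wa∉ (proj₁ (xs₁⁻ Wa))))
  ... | inj₁ Wa with xs-cases Wa
  ...   | inj₁ Wa₁ = inj₂ (cong₂ _+_ (σ-zero a Wa) (mult-∈ {W D a} {xs₁} xs₁-unique Wa₁))
  ...   | inj₂ Wa₂ = inj₁ (Wa₂ , cong₂ _+_ (σ-zero a Wa)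
            (mult-∉ {W D a} {xs₁} λ Wa₁ → proj₂ (xs₂⁻ Wa₂) (proj₂ (xs₁⁻ Wa₁))))
  mult≤1 : ∀ a → a ∈ A D → mult a μ ≤ 1
  mult≤1 a a∈ with source a a∈
  ... | inj₁ (_ , eq) rewrite m+n≡0⇒m≡0 (mult a μ) (trans (count a a∈) eq) = z≤n
  ... | inj₂ eq = subst (mult a μ ≤_) (trans (count a a∈) eq) (m≤m+n (mult a μ) (mult (E D a) xs₁))
  mult-W : ∀ a → a ∈ A D → W D a ∈ xs₂ → mult a μ ≡ 0
  mult-W a a∈ Wa = m+n≡0⇒m≡0 (mult a μ) (trans (count a a∈)
    (cong₂ _+_ (σ-zero a (proj₁ (xs₂⁻ Wa)))
               (mult-∉ {W D a} {xs₁} λ Wa₁ → proj₂ (xs₂⁻ Wa) (proj₂ (xs₁⁻ Wa₁)))))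
  mult-E : ∀ a → a ∈ A D → E D a ∈ xs₁ → mult a μ ≡ 0
  mult-E a a∈ Ea with source a a∈
  ... | inj₁ (_ , eq) = m+n≡0⇒m≡0 (mult a μ) (trans (count a a∈) eq)
  -- The edge entered once and has been consumed once.
  ... | inj₂ eq = +-cancelʳ-≡ 1 (mult a μ) 0
    (trans (cong (mult a μ +_) (sym (mult-∈ {E D a} {xs₁} xs₁-unique Ea))) (trans (count a a∈) eq))
  in-μ : ∀ a → a ∈ A D → E D a ∉ xs₁ → W D a ∉ xs₂ → a ∈ μ
  in-μ a a∈ Ea Wa with source a a∈
  ... | inj₁ (Wa₂ , _) = contradiction Wa₂ Wa
  ... | inj₂ eq = decidable-stable (a ∈? μ) λ a∉ →
    contradiction (trans (sym (cong₂ _+_ (mult-∉ {a} {μ} a∉) (mult-∉ {E D a} {xs₁} Ea)))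
                         (trans (count a a∈) eq)) λ ()

-- G is the piece cut off on the vertex set N, whose new vertices are on the side X.

record Piece (X : Side) (D : Graph) (C N : List ℕ) (ν : ℕ → ℕ) (G : Graph) : Set where
  field
    N⊆V      : ∀ {v} → v ∈ N → v ∈ V D
    C⊆A      : ∀ {a} → a ∈ C → a ∈ A D
    C-near   : ∀ {a} → a ∈ C → end (opp X) D a ∈ N
    C-far    : ∀ {a} → a ∈ C → end X D a ∉ N
    uncut    : ∀ {a} → a ∈ A D → a ∉ C → end (opp X) D a ∈ N → end X D a ∈ N
    uncut′   : ∀ {a} → a ∈ A D → a ∉ C → end X D a ∈ N → end (opp X) D a ∈ N
    fresh    : ∀ {a} → a ∈ C → ν a ∉ V D
    ν-inj    : ∀ {a b} → a ∈ C → b ∈ C → ν a ≡ ν b → a ≡ b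
    connected : ∀ u v → u ∈ N → v ∈ N → Σ (Semipath (removeEdges D C)) λ p → InSP _ p u v
    A-cases  : ∀ {a} → a ∈ A G → a ∈ C ⊎ (a ∈ A D × a ∉ C × end (opp X) D a ∈ N)
    A-all    : ∀ {a} → a ∈ A D → end (opp X) D a ∈ N → a ∈ A G
    V-cases  : ∀ {v} → v ∈ V G → v ∈ N ⊎ (∃ λ a → a ∈ C × v ≡ ν a)
    V-near   : ∀ {v} → v ∈ N → v ∈ V G
    V-new    : ∀ {a} → a ∈ C → ν a ∈ V G
    near-end : ∀ a → end (opp X) G a ≡ end (opp X) D a
    new-end  : ∀ {a} → a ∈ C → end X G a ≡ ν a
    far-end  : ∀ {a} → a ∉ C → end X G a ≡ end X D a

SweepAway-transfer : ∀ X {G H σ xs τ} → (∀ x → x ∈ xs → SameStar G H x) →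
  SweepAway X G σ xs τ → SweepAway X H σ xs τ
SweepAway-transfer west = Sweep-transfer
SweepAway-transfer east = Sweep-transfer

sides : ∀ X Y → Y ≡ X ⊎ Y ≡ opp X
sides west west = inj₁ refl
sides west east = inj₂ refl
sides east west = inj₂ refl
sides east east = inj₁ refl

Joins⇒ends : ∀ X G {a u v} → Joins G a u v →
  (end X G a ≡ u × end (opp X) G a ≡ v) ⊎ (end (opp X) G a ≡ u × end X G a ≡ v)
Joins⇒ends west G j = j
Joins⇒ends east G j = Sum.swap j

ends⇒Joins : ∀ X G {a u v} →
  (end X G a ≡ u × end (opp X) G a ≡ v) ⊎ (end (opp X) G a ≡ u × end X G a ≡ v) → Joins G a u v
ends⇒Joins west G j = j
ends⇒Joins east G j = Sum.swap j

-- The boundary list that a slice gives to a piece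

module PieceSlice {X : Side} {D : Graph} {C N : List ℕ} {ν : ℕ → ℕ} {G : Graph}
  (d : IsDGraph D) (P : Piece X D C N ν G) {σ xs τ : List ℕ}
  (sweep : SweepAway X D σ xs τ) (σ-unique : Unique σ)
  (xs⊆N : ∀ (x : ℕ) → x ∈ xs → x ∈ N) (xs-inner : ∀ (x : ℕ) → x ∈ xs → Inner D x)
  (N-inner : ∀ (x : ℕ) → Inner D x → x ∈ N → x ∈ xs)
  (σ⊆A : ∀ (a : ℕ) → a ∈ σ → a ∈ A D)
  (σ-far : ∀ (a : ℕ) → a ∈ σ → end X D a ∉ xs)
  (σ-all : ∀ (a : ℕ) → a ∈ A D → end X D a ∉ xs → end (opp X) D a ∈ N → a ∈ σ)
  (τ-edges : ∀ (a : ℕ) → a ∈ τ → IsEdgeOf (opp X) D a) where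
  open Piece P

  A⊆ : ∀ {a} → a ∈ A G → a ∈ A D
  A⊆ a∈ with A-cases a∈
  ... | inj₁ a∈C = C⊆A a∈C
  ... | inj₂ (a∈D , _) = a∈D

  near∈N : ∀ {a} → a ∈ A G → end (opp X) D a ∈ N
  near∈N a∈ with A-cases a∈
  ... | inj₁ a∈C = C-near a∈C
  ... | inj₂ (_ , _ , near) = near

  new≢old : ∀ {a v} → a ∈ C → v ∈ V D → end X G a ≢ v
  new≢old a∈C v∈ eq = fresh a∈C (subst (_∈ V D) (trans (sym eq) (new-end a∈C)) v∈)

  -- Otherwise the far end of `a` would be inner and in `N`, hence among the swept vertices, against
  -- `σ-far`.
  X-vertex-of-D : ∀ {a} → a ∈ σ → a ∈ A D → a ∉ C → end (opp X) D a ∈ N →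
    ∀ b → b ∈ A D → end (opp X) D b ≢ end X D a
  X-vertex-of-D {a} a∈σ a∈ a∉C near b b∈ eq =
    σ-far a a∈σ (N-inner _ (inner X (a∈ , refl) (b∈ , eq)) (uncut a∈ a∉C near))

  -- A cut edge has a fresh end of its own; any other edge of the piece in `σ` ends at an `X`-vertex
  -- of `D`, where functionality applies.
  pendant-σ : ∀ a → a ∈ σ → a ∈ A G → Pendant X G a
  pendant-σ a a∈σ a∈ with A-cases a∈
  ... | inj₁ a∈C = (a∈ , subst (_∈ V G) (sym (new-end a∈C)) (V-new a∈C) , none) , unique
    where
    none : ∀ b → b ∈ A G → end (opp X) G b ≢ end X G a
    none b b∈ eq = new≢old a∈C (end∈V d (opp X) (A⊆ b∈)) (trans (sym eq) (near-end b))
    unique : ∀ b → b ∈ A G → end X G b ≡ end X G a → b ≡ a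
    unique b b∈ eq with toSum (b ∈? C)
    ... | inj₁ b∈C = ν-inj b∈C a∈C (trans (sym (new-end b∈C)) (trans eq (new-end a∈C)))
    ... | inj₂ b∉C = ⊥-elim (new≢old a∈C (end∈V d X (A⊆ b∈)) (trans (sym eq) (far-end b∉C)))
  ... | inj₂ (a∈D , a∉C , near) =
    (a∈ , subst (_∈ V G) (sym (far-end a∉C)) (V-near (uncut a∈D a∉C near)) , none) , unique
    where
    none : ∀ b → b ∈ A G → end (opp X) G b ≢ end X G a
    none b b∈ eq = X-vertex-of-D a∈σ a∈D a∉C near b (A⊆ b∈)
      (trans (sym (near-end b)) (trans eq (far-end a∉C)))
    unique : ∀ b → b ∈ A G → end X G b ≡ end X G a → b ≡ a
    unique b b∈ eq with toSum (b ∈? C)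
    ... | inj₁ b∈C = ⊥-elim (new≢old b∈C (end∈V d X a∈D) (trans eq (far-end a∉C)))
    ... | inj₂ b∉C = edge-unique d X (end∈V d X a∈D , X-vertex-of-D a∈σ a∈D a∉C near)
      (a∈D , refl) (A⊆ b∈ , trans (sym (far-end b∉C)) (trans eq (far-end a∉C)))

  pendant-τ : ∀ a → a ∈ τ → a ∈ A G → Pendant (opp X) G a
  pendant-τ a a∈τ a∈ with τ-edges a a∈τ
  ... | a∈D , vertex@(v∈ , none) =
    (a∈ , subst (_∈ V G) (sym (near-end a)) (V-near (near∈N a∈)) ,
     subst (λ Y → ∀ b → b ∈ A G → end Y G b ≢ end (opp X) G a) (sym (opp-opp X)) none′) ,
    λ b b∈ eq → edge-unique d (opp X) vertex (a∈D , refl)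
                  (A⊆ b∈ , trans (sym (near-end b)) (trans eq (near-end a)))
    where
    none″ : ∀ b → b ∈ A D → end X D b ≢ end (opp X) D a
    none″ = subst (λ Y → ∀ b → b ∈ A D → end Y D b ≢ end (opp X) D a) (opp-opp X) none
    none′ : ∀ b → b ∈ A G → end X G b ≢ end (opp X) G a
    none′ b b∈ eq with toSum (b ∈? C)
    ... | inj₁ b∈C = new≢old b∈C v∈ (trans eq (near-end a))
    ... | inj₂ b∉C = none″ b (A⊆ b∈) (trans (sym (far-end b∉C)) (trans eq (near-end a)))

  -- Cutting leaves near ends alone, and no cut edge has its far end in `N`, nor its new end at an
  -- old vertex.
  same-star : ∀ x → x ∈ xs → SameStar D G x
  same-star x x∈ Y a with sides X Y
  ... | inj₂ refl = (λ { (a∈ , eq) → A-all a∈ (subst (_∈ N) (sym eq) (xs⊆N x x∈)) , trans (near-end a) eq }) ,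
                    (λ { (a∈ , eq) → A⊆ a∈ , trans (sym (near-end a)) eq })
  ... | inj₁ refl = to , from
    where
    to : At X D x a → At X G x a
    to (a∈ , eq) = A-all a∈ (uncut′ a∈ a∉C far) , trans (far-end a∉C) eq
      where
      far : end X D a ∈ N
      far = subst (_∈ N) (sym eq) (xs⊆N x x∈)
      a∉C : a ∉ C
      a∉C a∈C = C-far a∈C far
    from : At X G x a → At X D x a
    from (a∈ , eq) with toSum (a ∈? C)
    ... | inj₁ a∈C = ⊥-elim (new≢old a∈C (N⊆V (xs⊆N x x∈)) eq)
    ... | inj₂ a∉C = A⊆ a∈ , trans (sym (far-end a∉C)) eq

  half : Half X G σ xs τ
  half = record { unique = σ-unique ; sweep = SweepAway-transfer X same-star sweep
                ; pendant-σ = pendant-σ ; pendant-τ = pendant-τ }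

  slice : List ℕ
  slice = filter (_∈? A G) σ

  slice⁻ : ∀ {a} → a ∈ slice → a ∈ σ × a ∈ A G
  slice⁻ = ∈-filter⁻ (_∈? A G) {xs = σ}

  end-inj : ∀ {a b} → a ∈ σ → b ∈ σ → a ∈ A G → b ∈ A G → end X G a ≡ end X G b → a ≡ b
  end-inj a∈σ b∈σ a∈ b∈ eq = proj₂ (pendant-σ _ b∈σ b∈) _ a∈ eq

  C⊆σ : ∀ {a} → a ∈ C → a ∈ σ
  C⊆σ a∈C = σ-all _ (C⊆A a∈C) (λ far → C-far a∈C (xs⊆N _ far)) (C-near a∈C)

  C⊆AG : ∀ {a} → a ∈ C → a ∈ A G
  C⊆AG a∈C = A-all (C⊆A a∈C) (C-near a∈C)

  -- For completeness: a new vertex belongs to a cut edge, and all of these are in `σ`. An old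
  -- `X`-vertex carries an edge by its far end; that end is not swept, as swept vertices have edges
  -- on both sides, so this edge is in `σ` too.
  slice-list : IsListOf X G (map (end X G) slice)
  slice-list = map-unique slice (Unique-filter⁺ (_∈? A G) σ-unique) (λ a∈ → a∈) , sound , complete
    where
    map-unique : ∀ l → Unique l → (∀ {a} → a ∈ l → a ∈ slice) → Unique (map (end X G) l)
    map-unique [] u h = []
    map-unique (a ∷ l) (a≢ ∷ u) h = All.tabulate distinct ∷ map-unique l u (λ b∈ → h (there b∈))
      where
      distinct : ∀ {v} → v ∈ map (end X G) l → end X G a ≢ v
      distinct v∈ eq with ∈-map⁻ (end X G) v∈
      ... | b , b∈ , refl = All.lookup a≢ b∈
        (end-inj (proj₁ (slice⁻ (h (here refl)))) (proj₁ (slice⁻ (h (there b∈))))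
                 (proj₂ (slice⁻ (h (here refl)))) (proj₂ (slice⁻ (h (there b∈)))) eq)
    sound : ∀ v → v ∈ map (end X G) slice → IsVertexOf X G v
    sound v v∈ with ∈-map⁻ (end X G) v∈
    ... | a , a∈ , refl = end-vertex half (proj₁ (slice⁻ a∈)) (proj₂ (slice⁻ a∈))
    in-slice : ∀ {a v} → a ∈ σ → a ∈ A G → end X G a ≡ v → v ∈ map (end X G) slice
    in-slice a∈σ a∈ refl = ∈-map⁺ (end X G) (∈-filter⁺ (_∈? A G) a∈σ a∈)
    complete : ∀ v → IsVertexOf X G v → v ∈ map (end X G) slice
    complete v (v∈ , none) with V-cases v∈
    ... | inj₂ (a , a∈C , refl) = in-slice (C⊆σ a∈C) (C⊆AG a∈C) (new-end a∈C)
    ... | inj₁ v∈N with incident-edge d (N⊆V v∈N)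
    ...   | Y , a , a∈ , eq with sides X Y
    ...     | inj₂ refl = contradiction (trans (near-end a) eq)
            (none a (A-all a∈ (subst (_∈ N) (sym eq) v∈N)))
    ...     | inj₁ refl = in-slice (σ-all a a∈ far∉xs near) (A-all a∈ near) (trans (far-end a∉C) eq)
      where
      far : end X D a ∈ N
      far = subst (_∈ N) (sym eq) v∈N
      a∉C : a ∉ C
      a∉C a∈C = C-far a∈C far
      near : end (opp X) D a ∈ N
      near = uncut′ a∈ a∉C far
      far∉xs : end X D a ∉ xs
      far∉xs far∈ with xs-inner _ far∈ (opp X)
      ... | b , b∈ , eq′ = none b (A-all b∈ (subst (_∈ N) (sym (trans eq′ eq)) v∈N))
                                  (trans (near-end b) (trans eq′ eq))

  slice-grounded : Grounded X G (map (end X G) slice)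
  slice-grounded = grounded half

  uncut-Joins : ∀ {a u v} → a ∈ A D → a ∉ C → Joins D a u v → u ∈ N → a ∈ A G × Joins G a u v × v ∈ N
  uncut-Joins {a} a∈ a∉C j u∈ with Joins⇒ends X D j
  ... | inj₁ (refl , refl) =
    A-all a∈ near , ends⇒Joins X G (inj₁ (far-end a∉C , near-end a)) , near
    where
    near : end (opp X) D a ∈ N
    near = uncut′ a∈ a∉C u∈
  ... | inj₂ (refl , refl) =
    A-all a∈ u∈ , ends⇒Joins X G (inj₂ (near-end a , far-end a∉C)) , uncut a∈ a∉C u∈

  -- An edge outside `C` with one end in `N` has both ends there, so the semipath never leaves the
  -- piece.
  uncut-trail : ∀ u s → Linked (removeEdges D C) u s → u ∈ N → ∃ λ es → Trail G u es (lastV u s)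
  uncut-trail u [] _ _ = [] , []
  uncut-trail u ((a , v) ∷ s) (a∈ , _ , j , l) u∈
    with a∈D , a∉C ← ∈-filter⁻ (λ a → ¬? (a ∈? C)) {xs = A D} a∈
    with a∈G , jG , v∈ ← uncut-Joins a∈D a∉C j u∈
    with es , t ← uncut-trail v s l v∈ = a ∷ es , via a∈G jG t

  -- Go along `i` to its near end, through the connected set `N`, and out along `k`.
  end-trail : ∀ {i k} → i ∈ A G → k ∈ A G → ∃ λ es → Trail G (end X G i) es (end X G k)
  end-trail {i} {k} i∈ k∈ with connected _ _ (near∈N i∈) (near∈N k∈)
  ... | p , start≡ , end≡
    with uncut-trail (start p) (steps p) (linked p) (subst (_∈ N) (sym start≡) (near∈N i∈))
  ... | es , t with subst (λ v → Trail G (start p) es v) end≡ t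
                    ∷ʳᵗ (k∈ , ends⇒Joins X G (inj₂ (near-end k , refl)))
  ... | fs , t′ = i ∷ fs , via i∈ (ends⇒Joins X G (inj₁ (refl , near-end i)))
                            (subst (λ u → Trail G u fs (end X G k)) start≡ t′)

  -- The piece is connected, so an edge outside it could not separate two of its edges in the slice.
  slice-convex : ∀ {i j k} → (i ∷ j ∷ k ∷ []) ⊑ σ → i ∈ A G → k ∈ A G → j ∈ A G
  slice-convex {j = j} s i∈ k∈ = decidable-stable (j ∈? A G) λ j∉ →
    no-strand-between half s i∈ k∈ j∉ (proj₂ (end-trail i∈ k∈))

-- The two pieces of a cocycle and their P-compatibility

cutW-piece : ∀ {D C V₁ V₂ ν} → IsCocycle D C V₁ V₂ → FreshNames D C ν →
  (∀ {a} → a ∈ C → a ∈ A D) → Piece east D C V₁ ν (cutW D C V₁ ν)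
cutW-piece {D} {C} {V₁} {V₂} {ν}
  (_ , _ , _ , _ , _ , _ , _ , disj , _ , V₁⊆ , _ , conn₁ , _ , uncut , cut) (fresh , ν-inj) C⊆A = record
  { N⊆V = V₁⊆ _ ; C⊆A = C⊆A
  ; C-near = λ a∈ → proj₁ (cut _ a∈)
  ; C-far = λ a∈ E∈ → disj (E∈ , proj₂ (cut _ a∈))
  ; uncut = λ a∈ a∉ W∈ → [ proj₂ , (λ w → ⊥-elim (disj (W∈ , proj₁ w))) ]′ (uncut _ a∈ a∉)
  ; uncut′ = λ a∈ a∉ E∈ → [ proj₁ , (λ w → ⊥-elim (disj (E∈ , proj₂ w))) ]′ (uncut _ a∈ a∉)
  ; fresh = fresh _ ; ν-inj = ν-inj _ _ ; connected = conn₁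
  ; A-cases = A-cases
  ; A-all = A-all
  ; V-cases = λ v∈ → Sum.map₂ (∈-map⁻ ν) (∈-++⁻ V₁ v∈)
  ; V-near = ∈-++⁺ˡ
  ; V-new = λ a∈ → ∈-++⁺ʳ V₁ (∈-map⁺ ν a∈)
  ; near-end = λ a → refl
  ; new-end = λ {a} a∈ → cong (λ b → if b then ν a else E D a) (dec-true (a ∈? C) a∈)
  ; far-end = λ {a} a∉ → cong (λ b → if b then ν a else E D a) (dec-false (a ∈? C) a∉) }
  where
  A-cases : ∀ {a} → a ∈ edgesIn D C V₁ ++ C → a ∈ C ⊎ (a ∈ A D × a ∉ C × W D a ∈ V₁)
  A-cases a∈ with ∈-++⁻ (edgesIn D C V₁) a∈
  ... | inj₂ a∈C = inj₁ a∈C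
  ... | inj₁ a∈′ with ∈-filter⁻ (λ a → W D a ∈? V₁) {xs = A (removeEdges D C)} a∈′
  ...   | a∈″ , W∈ with ∈-filter⁻ (λ a → ¬? (a ∈? C)) {xs = A D} a∈″
  ...     | a∈D , a∉C = inj₂ (a∈D , a∉C , W∈)
  A-all : ∀ {a} → a ∈ A D → W D a ∈ V₁ → a ∈ edgesIn D C V₁ ++ C
  A-all {a} a∈ W∈ with toSum (a ∈? C)
  ... | inj₁ a∈C = ∈-++⁺ʳ (edgesIn D C V₁) a∈C
  ... | inj₂ a∉C = ∈-++⁺ˡ (∈-filter⁺ (λ a → W D a ∈? V₁) (∈-filter⁺ (λ a → ¬? (a ∈? C)) a∈ a∉C) W∈)

cutE-piece : ∀ {D C V₁ V₂ ν} → IsCocycle D C V₁ V₂ → FreshNames D C ν →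
  (∀ {a} → a ∈ C → a ∈ A D) → Piece west D C V₂ ν (cutE D C V₂ ν)
cutE-piece {D} {C} {V₁} {V₂} {ν}
  (_ , _ , _ , _ , _ , _ , _ , disj , _ , _ , V₂⊆ , _ , conn₂ , uncut , cut) (fresh , ν-inj) C⊆A = record
  { N⊆V = V₂⊆ _ ; C⊆A = C⊆A
  ; C-near = λ a∈ → proj₂ (cut _ a∈)
  ; C-far = λ a∈ W∈ → disj (proj₁ (cut _ a∈) , W∈)
  ; uncut = E⇒W
  ; uncut′ = λ a∈ a∉ W∈ → [ (λ w → ⊥-elim (disj (proj₁ w , W∈))) , proj₂ ]′ (uncut _ a∈ a∉)
  ; fresh = fresh _ ; ν-inj = ν-inj _ _ ; connected = conn₂
  ; A-cases = A-cases
  ; A-all = A-all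
  ; V-cases = λ v∈ → Sum.map₂ (∈-map⁻ ν) (∈-++⁻ V₂ v∈)
  ; V-near = ∈-++⁺ˡ
  ; V-new = λ a∈ → ∈-++⁺ʳ V₂ (∈-map⁺ ν a∈)
  ; near-end = λ a → refl
  ; new-end = λ {a} a∈ → cong (λ b → if b then ν a else W D a) (dec-true (a ∈? C) a∈)
  ; far-end = λ {a} a∉ → cong (λ b → if b then ν a else W D a) (dec-false (a ∈? C) a∉) }
  where
  -- Edges of the piece are selected by their west ends, whereas the near end is here the east one.
  E⇒W : ∀ {a} → a ∈ A D → a ∉ C → E D a ∈ V₂ → W D a ∈ V₂
  E⇒W a∈ a∉ E∈ = [ (λ w → ⊥-elim (disj (proj₂ w , E∈))) , proj₁ ]′ (uncut _ a∈ a∉)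
  A-cases : ∀ {a} → a ∈ edgesIn D C V₂ ++ C → a ∈ C ⊎ (a ∈ A D × a ∉ C × E D a ∈ V₂)
  A-cases a∈ with ∈-++⁻ (edgesIn D C V₂) a∈
  ... | inj₂ a∈C = inj₁ a∈C
  ... | inj₁ a∈′ with ∈-filter⁻ (λ a → W D a ∈? V₂) {xs = A (removeEdges D C)} a∈′
  ...   | a∈″ , W∈ with ∈-filter⁻ (λ a → ¬? (a ∈? C)) {xs = A D} a∈″
  ...     | a∈D , a∉C = inj₂ (a∈D , a∉C ,
    [ (λ w → ⊥-elim (disj (proj₁ w , W∈))) , proj₂ ]′ (uncut _ a∈D a∉C))
  A-all : ∀ {a} → a ∈ A D → E D a ∈ V₂ → a ∈ edgesIn D C V₂ ++ C
  A-all {a} a∈ E∈ with toSum (a ∈? C)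
  ... | inj₁ a∈C = ∈-++⁺ʳ (edgesIn D C V₂) a∈C
  ... | inj₂ a∉C =
    ∈-++⁺ˡ (∈-filter⁺ (λ a → W D a ∈? V₂) (∈-filter⁺ (λ a → ¬? (a ∈? C)) a∈ a∉C) (E⇒W a∈ a∉C E∈))

-- Both lists come from the one slice `μ`: restricted to the edges of each piece, it gives the
-- boundary vertices on the cut side in order.
cut-P-compatible : ∀ {D LW LE} → Construction D LW LE →
  ∀ C V₁ V₂ ν → IsCocycle D C V₁ V₂ → FreshNames D C ν → PCompatible (cutW D C V₁ ν) (cutE D C V₂ ν)
cut-P-compatible {D} k C V₁ V₂ ν
  cocycle@(_ , C≢[] , C-inner , _ , _ , _ , _ , disj , V-cover , V₁⊆ , V₂⊆ , _ , _ , uncut , cut) names =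
  map (E GW) SW.slice , map (W GE) SE.slice ,
  SW.slice-list , SW.slice-grounded , SE.slice-list , SE.slice-grounded ,
  compatible (E GW) (W GE) μ μ-unique SW.end-inj SE.end-inj
    (λ { (a∈W , a∈E) → agree a∈W a∈E }) (λ _ _ → apart)
    cover SW.slice-convex SE.slice-convex
    (c , SW.C⊆σ c∈C , SW.C⊆AG c∈C , SE.C⊆AG c∈C)
  where
  d : IsDGraph D
  d = proj₁ (construction-data k)
  lw : IsListOf west D _
  lw = proj₁ (proj₂ (construction-data k))
  le : IsListOf east D _
  le = proj₂ (proj₂ (construction-data k))
  dr : Drawing D _ _
  dr = construction-drawing k
  C⊆A : ∀ {a} → a ∈ C → a ∈ A D
  C⊆A a∈ = proj₁ (C-inner _ a∈)
  GW GE : Graph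
  GW = cutW D C V₁ ν
  GE = cutE D C V₂ ν
  PW : Piece east D C V₁ ν GW
  PW = cutW-piece cocycle names C⊆A
  PE : Piece west D C V₂ ν GE
  PE = cutE-piece cocycle names C⊆A
  -- Cut edges lead from `V₁` to `V₂`, so no edge enters `V₁` from `V₂` and the vertices of `V₁` can
  -- be swept first.
  closed : ∀ a → a ∈ A D → E D a ∈ V₁ → W D a ∈ V₁
  closed a a∈ E∈ with toSum (a ∈? C)
  ... | inj₁ a∈C = proj₁ (cut a a∈C)
  ... | inj₂ a∉C = Piece.uncut′ PW a∈ a∉C E∈
  open MiddleSlice (middle-slice d lw dr V₁ closed)
  xs₂⊆V₂ : ∀ x → x ∈ xs₂ → x ∈ V₂
  xs₂⊆V₂ x x∈ = [ (λ x∈V₁ → ⊥-elim (xs₂∩U x x∈ x∈V₁)) , id ]′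
                (V-cover x (Inner⇒∈V d (Sweep⇒Inner upper x x∈)))
  -- The west piece has its new vertices in the east, so the lower sweep is read backwards, from `μ`
  -- to the W-edges of `D`.
  module SW = PieceSlice d PW lower μ-unique xs₁⊆U (Sweep⇒Inner lower)
    (λ x i x∈ → [ id , (λ x∈₂ → ⊥-elim (xs₂∩U x x∈₂ x∈)) ]′ (xs-all x i))
    μ⊆A μ-lower
    (λ a a∈ E∉ W∈ → μ-all a a∈ E∉ (λ W∈₂ → xs₂∩U _ W∈₂ W∈))
    (proj₁ (proj₂ (boundary-Enumerates d west lw (Drawing.map-σ dr) (Drawing.σ⊆A dr))))
  module SE = PieceSlice d PE upper μ-unique xs₂⊆V₂ (Sweep⇒Inner upper)
    (λ x i x∈ → [ (λ x∈₁ → ⊥-elim (disj (xs₁⊆U x x∈₁ , x∈))) , id ]′ (xs-all x i))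
    μ⊆A μ-upper
    (λ a a∈ W∉ E∈ → μ-all a a∈ (λ E∈₁ → disj (xs₁⊆U _ E∈₁ , E∈)) W∉)
    (proj₁ (proj₂ (boundary-Enumerates d east le (Drawing.map-τ dr) (Drawing.τ⊆A dr))))
  open Halves (A GW) (A GE)
  c : ℕ
  c = proj₁ (some-∈ C≢[])
  c∈C : c ∈ C
  c∈C = proj₂ (some-∈ C≢[])
  cover : Cover μ
  cover a a∈ with toSum (a ∈? C)
  ... | inj₁ a∈C = inj₁ (SW.C⊆AG a∈C)
  ... | inj₂ a∉C = Sum.map (λ w → Piece.A-all PW (μ⊆A a a∈) (proj₁ w))
                           (λ w → Piece.A-all PE (μ⊆A a a∈) (proj₂ w)) (uncut a (μ⊆A a a∈) a∉C)
  agree : ∀ {a} → a ∈ A GW → a ∈ A GE → E GW a ≡ W GE a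
  agree {a} a∈W a∈E with toSum (a ∈? C)
  ... | inj₁ a∈C = trans (Piece.new-end PW a∈C) (sym (Piece.new-end PE a∈C))
  ... | inj₂ a∉C = ⊥-elim (disj (Piece.uncut PW (SW.A⊆ a∈W) a∉C (SW.near∈N a∈W) , SE.near∈N a∈E))
  far-V₁ : ∀ {a} → Only (A GW) (A GE) a → E GW a ∈ V₁
  far-V₁ {a} (a∈W , a∉E) = subst (_∈ V₁) (sym (Piece.far-end PW a∉C))
    (Piece.uncut PW (SW.A⊆ a∈W) a∉C (SW.near∈N a∈W))
    where
    a∉C : a ∉ C
    a∉C a∈C = a∉E (SE.C⊆AG a∈C)
  far-V₂ : ∀ {a} → Only (A GE) (A GW) a → W GE a ∈ V₂
  far-V₂ {a} (a∈E , a∉W) = subst (_∈ V₂) (sym (Piece.far-end PE a∉C))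
    (Piece.uncut PE (SE.A⊆ a∈E) a∉C (SE.near∈N a∈E))
    where
    a∉C : a ∉ C
    a∉C a∈C = a∉W (SW.C⊆AG a∈C)
  apart : ∀ {a b} → Only (A GW) (A GE) a → Only (A GE) (A GW) b → E GW a ≢ W GE b
  apart a-only b-only eq = disj (far-V₁ a-only , subst (_∈ V₂) (sym eq) (far-V₂ b-only))

theorem2p3p6 : (D : Graph) → IsP′Graph D → IsP‴Graph D
theorem2p3p6 D (LW , LE , k) = proj₁ (construction-data k) , cut-P-compatible k
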